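{- A function $f\colon\Sigma^*\to\Gamma^*$ is defined by an FO translation if and only if it is defined by a single-valued aperiodic finite transducer.
   Context: Words $w=w_1\cdots w_n$ over a finite alphabet $\Sigma$ are viewed as finite structures with universe $\{1,\dots,n\}$, unary predicates $P_a$ ($P_a(j)$ iff $w_j=a$), the linear order $<$, equality, and constants min, max; FO denotes first-order logic over this signature (no BIT). An FO translation to the ordered alphabet $\Gamma=(c_1,\dots,c_t)$ is given by FO formulas $\phi_1(x),\dots,\phi_{t-1}(x)$ with one free variable $x$; it maps $w$ of length $n$ to the word $v$ of length $n$ with $v_i=c_j$ for the least $j$ such that $w\models\phi_j(i)$, and $v_i=c_t$ if there is no such $j$. A finite transducer $M$ consists of a finite set $Q$ of states, input alphabet $\Sigma$, output alphabet $\Gamma$, initial state $q_0$, transition relation $\delta\subseteq Q\times\Sigma\times\Gamma\times Q$ and final states $F\subseteq Q$. For $w=w_1\cdots w_n$, the set $O_M(w)$ consists of all $v\in\Gamma^n$ for which there are states $s_0=q_0,s_1,\dots,s_n$ with $s_n\in F$ and $(s_{i-1},w_i,v_i,s_i)\in\delta$ for all $1\le i\le n$. $M$ is single-valued if $|O_M(w)|=1$ for every $w\in\Sigma^*$; it then defines the function mapping $w$ to the unique element of $O_M(w)$. For a state $s$ and $u\in\Sigma^*$, $\delta^*(s,u)$ is the set of states reachable from $s$ by reading $u$ (with any outputs). $M$ is aperiodic if there is $N\in\mathbb N$ such that $\delta^*(q,w^N)=\delta^*(q,w^{N+1})$ for all states $q$ and all words $w$. -}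

module Defs where

open import Data.Nat using (ℕ; zero; suc; _<ᵇ_; _≡ᵇ_)
open import Data.Fin using (Fin; zero; suc; toℕ; fromℕ; inject₁)
open import Data.Fin.Properties using (_≟_)
open import Data.Bool using (Bool; true; false; if_then_else_; _∧_; _∨_; not; T)
open import Data.List using (List; []; _∷_; _++_; length; concat; replicate)
open import Data.Vec using (Vec; lookup; tabulate; fromList; toList)
open import Data.Product using (Σ; ∃; _×_; _,_)
open import Relation.Nullary.Decidable using (⌊_⌋)
open import Relation.Binary.PropositionalEquality using (_≡_)
open import Function.Bundles using (_⇔_)

-- Words over the alphabet Σ = Fin s are lists; positions of a word of
-- length n are Fin n (position i here is position i+1 in the paper).

Word : ℕ → Set
Word s = List (Fin s)

-- First-order logic over words: signature P_a (a ∈ Σ), <, =, min, max.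
-- Formula s m : formulas over alphabet Fin s with free variables Fin m
-- (de Bruijn; ∃' binds variable zero).

data Term (m : ℕ) : Set where
  var : Fin m → Term m
  tmin tmax : Term m

data Formula (s : ℕ) (m : ℕ) : Set where
  P     : Fin s → Term m → Formula s m
  _<'_  : Term m → Term m → Formula s m
  _≐_   : Term m → Term m → Formula s m
  ¬'_   : Formula s m → Formula s m
  _∧'_  : Formula s m → Formula s m → Formula s m
  _∨'_  : Formula s m → Formula s m → Formula s m
  ∃'_   : Formula s (suc m) → Formula s m
  ∀'_   : Formula s (suc m) → Formula s m

-- semantics on a nonempty word (universe Fin (suc n)); formulas with a
-- free variable are only ever evaluated on nonempty words.
anyFin : ∀ {n} → (Fin n → Bool) → Bool
anyFin {zero}  p = false
anyFin {suc n} p = p zero ∨ anyFin (λ i → p (suc i))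

allFin : ∀ {n} → (Fin n → Bool) → Bool
allFin {zero}  p = true
allFin {suc n} p = p zero ∧ allFin (λ i → p (suc i))

extend : ∀ {m} {A : Set} → A → (Fin m → A) → Fin (suc m) → A
extend a ρ zero    = a
extend a ρ (suc k) = ρ k

evalT : ∀ {m n} → (Fin m → Fin (suc n)) → Term m → Fin (suc n)
evalT ρ (var x) = ρ x
evalT ρ tmin    = zero
evalT {n = n} ρ tmax = fromℕ n

sat : ∀ {s m n} → Vec (Fin s) (suc n) → Formula s m → (Fin m → Fin (suc n)) → Bool
sat w (P a x)    ρ = ⌊ lookup w (evalT ρ x) ≟ a ⌋
sat w (x <' y)   ρ = toℕ (evalT ρ x) <ᵇ toℕ (evalT ρ y)
sat w (x ≐ y)    ρ = toℕ (evalT ρ x) ≡ᵇ toℕ (evalT ρ y)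
sat w (¬' φ)     ρ = not (sat w φ ρ)
sat w (φ ∧' ψ)   ρ = sat w φ ρ ∧ sat w ψ ρ
sat w (φ ∨' ψ)   ρ = sat w φ ρ ∨ sat w ψ ρ
sat w (∃' φ)     ρ = anyFin (λ i → sat w φ (extend i ρ))
sat w (∀' φ)     ρ = allFin (λ i → sat w φ (extend i ρ))

-- FO translations to the ordered alphabet Γ = Fin (suc t) = (c_1,…,c_{t+1}),
-- given by t formulas φ_1,…,φ_t with one free variable.

pick : ∀ {t} → (Fin t → Bool) → Fin (suc t)
pick {zero}  p = zero
pick {suc t} p = if p zero then zero else suc (pick (λ j → p (suc j)))

translate : ∀ {s t} → Vec (Formula s 1) t → Word s → Word (suc t)
translate φs []      = []
translate φs (a ∷ u) =
  toList (tabulate (λ i → pick (λ j → sat (fromList (a ∷ u)) (lookup φs j) (λ _ → i))))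

DefinedByFOTranslation : ∀ {s t} → (Word s → Word (suc t)) → Set
DefinedByFOTranslation {s} {t} f =
  Σ (Vec (Formula s 1) t) λ φs → ∀ w → f w ≡ translate φs w

record Transducer (s t : ℕ) : Set where
  field
    nQ : ℕ
    q₀ : Fin nQ
    δ  : Fin nQ → Fin s → Fin (suc t) → Fin nQ → Bool
    F  : Fin nQ → Bool

module _ {s t : ℕ} (M : Transducer s t) where
  open Transducer M

  data Run : Fin nQ → Word s → Word (suc t) → Fin nQ → Set where
    done : ∀ {p} → Run p [] [] p
    step : ∀ {p a b p' u v p''} → T (δ p a b p') → Run p' u v p'' →
           Run p (a ∷ u) (b ∷ v) p''

  Output : Word s → Word (suc t) → Set
  Output w v = Σ (Fin nQ) λ p → Run q₀ w v p × T (F p)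

  Reach : Fin nQ → Word s → Fin nQ → Set
  Reach p u p' = Σ (Word (suc t)) λ v → Run p u v p'

  SingleValued : Set
  SingleValued = ∀ w → Σ (Word (suc t)) λ v → Output w v × (∀ v' → Output w v' → v' ≡ v)

  Aperiodic : Set
  Aperiodic = Σ ℕ λ N → ∀ (p : Fin nQ) (u : Word s) (p' : Fin nQ) →
    Reach p (concat (replicate N u)) p' ⇔ Reach p (concat (replicate (suc N) u)) p'

  Defines : (Word s → Word (suc t)) → Set
  Defines f = ∀ w → Output w (f w) × (∀ v → Output w v → v ≡ f w)

{-# OPTIONS --safe #-}
module Submission where

-- From formulas to transducers: relations on marked words that are recognised by
-- aperiodic automata are closed under Boolean operations and, by an automaton that
-- guesses the marked position, under quantification. The transducer tracks the state
-- of such an automaton for all the φⱼ and guesses the transformation of its states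
-- induced by the unread suffix, which determines the output letter.
--
-- From transducers to formulas (after Wilke): a deterministic aperiodic run over a
-- definable labelling is definable, by induction on the number of states and letters.
-- A letter acting surjectively acts as the identity, by aperiodicity, and can be
-- dropped. A letter c that misses a state cuts the word into blocks; the blocks act on
-- one state fewer, and between two occurrences of c there is one letter fewer. Applied
-- to the subset automaton of the transducer, this defines the states reachable before
-- a position and those from which the rest of the word is accepted.

open import Defs
open import Data.Bool using (Bool; true; false; T; if_then_else_; not; _∧_; _∨_)
open import Data.Bool.Properties using (T-∧; T-∨; T?)
open import Data.Empty using (⊥; ⊥-elim)
open import Data.Fin
  using (Fin; zero; suc; toℕ; fromℕ; fromℕ<; inject₁; punchIn; punchOut; finToFun; funToFin;
         combine; remQuot)
open import Data.Fin.Properties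
  using (_≟_; toℕ-fromℕ; toℕ-fromℕ<; toℕ<n; toℕ≤pred[n]; toℕ-injective; suc-injective; any?; all?;
         ¬∀⟶∃¬; punchIn-injective; punchIn-punchOut; finToFun-funToFin; funToFin-finToFin;
         remQuot-combine; combine-remQuot)
open import Data.List
  using (List; []; _∷_; [_]; _++_; foldl; foldr; map; tabulate; length; concat; replicate; take;
         drop)
open import Data.List.Properties using (foldl-++; map-++; map-tabulate; ++-assoc)
open import Data.Maybe using (Maybe; just; nothing)
open import Data.Maybe.Properties using (just-injective)
open import Data.Nat using (ℕ; zero; suc; _+_; _*_; _∸_; _^_; _<_; _≤_; _<ᵇ_; _≡ᵇ_; s≤s; z<s; s<s)
open import Data.Nat.GeneralisedArithmetic using (fold)
open import Data.Nat.Properties as ℕ using (<ᵇ⇒<; <⇒<ᵇ; ≡ᵇ⇒≡; ≡⇒≡ᵇ)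
open import Data.Product using (Σ; ∃; ∃₂; _×_; _,_; proj₁; proj₂; uncurry)
open import Data.Product.Function.NonDependent.Propositional using (_×-⇔_)
open import Data.Sum using (_⊎_; inj₁; inj₂)
open import Data.Sum.Function.Propositional using (_⊎-⇔_)
open import Data.Unit using (tt)
open import Data.Vec as Vec using (Vec; lookup; fromList; toList)
open import Data.Vec.Properties as Vec using (lookup∘tabulate)
open import Function using (_∘_; id; case_of_)
open import Function.Bundles using (_⇔_; mk⇔; Equivalence)
open import Function.Construct.Composition using (_⇔-∘_)
open import Relation.Binary.Definitions using (tri<; tri≈; tri>)
open import Relation.Binary.PropositionalEquality hiding ([_])
open import Relation.Nullary using (¬_; Dec; yes; no; contradiction)
open import Relation.Nullary.Decidable using (toWitness; fromWitness; _×-dec_; _⊎-dec_; ⌊_⌋)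

open Equivalence

-- From transducers to formulas, aperiodicity is inherited through the induction and exploited at
-- one point: it rules out letters that permute the states nontrivially. Two obstacles shape the
-- induction. Contracting blocks to letters yields an alphabet of `q ^ q` transformations, so the
-- number of states must come before the number of letters in the order. And the new letters are not
-- letters of the word: formulas attach them to positions, so the claim is made for arbitrary
-- definable labellings with parameters, in which some positions may be unlabelled. The final
-- formula says only that some accepting run writes a given letter at a position; uniqueness of the
-- output makes these letters form one word.
--
-- In the other direction, negation wants deterministic automata while quantification makes them
-- guess, so a subset construction must preserve aperiodicity. It does because only one position is
-- guessed: of many repetitions of a word, all but one are read unmarked.

anyFin-⇔ : ∀ {n} (p : Fin n → Bool) → T (anyFin p) ⇔ ∃ λ i → T (p i)
anyFin-⇔ {zero}  p = mk⇔ (λ ()) (λ ())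
anyFin-⇔ {suc n} p = mk⇔ fwd bwd
  where
  fwd : T (anyFin p) → ∃ λ i → T (p i)
  fwd h with to T-∨ h
  ... | inj₁ h₀ = zero , h₀
  ... | inj₂ h₁ with to (anyFin-⇔ (p ∘ suc)) h₁
  ... | i , pᵢ = suc i , pᵢ
  bwd : (∃ λ i → T (p i)) → T (anyFin p)
  bwd (zero  , pᵢ) = from T-∨ (inj₁ pᵢ)
  bwd (suc i , pᵢ) = from T-∨ (inj₂ (from (anyFin-⇔ (p ∘ suc)) (i , pᵢ)))

allFin-⇔ : ∀ {n} (p : Fin n → Bool) → T (allFin p) ⇔ (∀ i → T (p i))
allFin-⇔ {zero}  p = mk⇔ (λ _ ()) (λ _ → tt)
allFin-⇔ {suc n} p = mk⇔
  (λ h → λ { zero → proj₁ (to T-∧ h) ; (suc i) → to (allFin-⇔ (p ∘ suc)) (proj₂ (to T-∧ h)) i })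
  (λ h → from T-∧ (h zero , from (allFin-⇔ (p ∘ suc)) (h ∘ suc)))

T-not : ∀ b → T (not b) ⇔ (¬ T b)
T-not true  = mk⇔ (λ ()) (λ h → h tt)
T-not false = mk⇔ (λ _ ()) (λ _ → tt)

suc² : ∀ {n} → Fin n → Fin (suc (suc n))
suc² i = suc (suc i)

funToFin-cong : ∀ {m n} {f g : Fin m → Fin n} → f ≗ g → funToFin f ≡ funToFin g
funToFin-cong {zero}  h = refl
funToFin-cong {suc m} h = cong₂ combine (h zero) (funToFin-cong (h ∘ suc))

-- Definable relations on the positions of words

Structural : ℕ → ℕ → Set₁
Structural s m = ∀ {n} → Vec (Fin s) (suc n) → (Fin m → Fin (suc n)) → Set

record Definable {s m} (R : Structural s m) : Set where
  constructor _by_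
  field
    formula : Formula s m
    correct : ∀ {n} (w : Vec (Fin s) (suc n)) ρ → T (sat w formula ρ) ⇔ R w ρ

open Definable

module _ {s : ℕ} where

  private variable
    m : ℕ
    A : Set

  def-resp : {R S : Structural s m} →
    Definable R → (∀ {n} (w : Vec (Fin s) (suc n)) ρ → R w ρ ⇔ S w ρ) → Definable S
  def-resp (φ by c) e = φ by λ w ρ → e w ρ ⇔-∘ c w ρ

  def-× : {R S : Structural s m} → Definable R → Definable S →
    Definable (λ w ρ → R w ρ × S w ρ)
  def-× (φ by c) (ψ by d) = (φ ∧' ψ) by λ w ρ → (c w ρ ×-⇔ d w ρ) ⇔-∘ T-∧

  def-⊎ : {R S : Structural s m} → Definable R → Definable S →
    Definable (λ w ρ → R w ρ ⊎ S w ρ)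
  def-⊎ (φ by c) (ψ by d) = (φ ∨' ψ) by λ w ρ → (c w ρ ⊎-⇔ d w ρ) ⇔-∘ T-∨

  def-¬ : {R : Structural s m} → Definable R → Definable (λ w ρ → ¬ R w ρ)
  def-¬ (φ by c) = (¬' φ) by λ w ρ →
    mk⇔ (λ h r → to (T-not _) h (from (c w ρ) r)) (λ h → from (T-not _) (h ∘ to (c w ρ)))

  def-∃ : {R : ∀ {n} → Vec (Fin s) (suc n) → (Fin m → Fin (suc n)) → Fin (suc n) → Set} →
    Definable {m = suc m} (λ w ρ → R w (ρ ∘ suc) (ρ zero)) → Definable (λ w ρ → ∃ (R w ρ))
  def-∃ (φ by c) = (∃' φ) by λ w ρ → let e = anyFin-⇔ (λ i → sat w φ (extend i ρ)) in
    mk⇔ (λ h → let i , hᵢ = to e h in i , to (c w (extend i ρ)) hᵢ)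
        (λ (i , r) → from e (i , from (c w (extend i ρ)) r))

  def-dec : Dec A → Definable {s} {m} (λ _ _ → A)
  def-dec (yes a) = (tmin ≐ tmin) by λ w ρ → mk⇔ (λ _ → a) (λ _ → tt)
  def-dec (no ¬a) = (¬' (tmin ≐ tmin)) by λ w ρ → mk⇔ (λ ()) ¬a

  def-∃Fin : ∀ {q} {R : Fin q → Structural s m} → (∀ r → Definable (R r)) →
    Definable (λ w ρ → ∃ λ r → R r w ρ)
  def-∃Fin {q = zero}  d = def-resp (def-dec (no λ ())) (λ w ρ → mk⇔ ⊥-elim λ { (() , _) })
  def-∃Fin {q = suc q} d = def-resp
    (def-⊎ (d zero) (def-∃Fin (d ∘ suc)))
    (λ w ρ → mk⇔ (λ { (inj₁ h) → zero , h ; (inj₂ (r , h)) → suc r , h })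
                  (λ { (zero , h) → inj₁ h ; (suc r , h) → inj₂ (r , h) }))

  def-∀Fin : ∀ {q} {R : Fin q → Structural s m} → (∀ r → Definable (R r)) →
    Definable (λ w ρ → ∀ r → R r w ρ)
  def-∀Fin {q = zero}  d = def-resp (def-dec (yes tt)) (λ w ρ → mk⇔ (λ _ ()) (λ _ → tt))
  def-∀Fin {q = suc q} d = def-resp
    (def-× (d zero) (def-∀Fin (d ∘ suc)))
    (λ w ρ → mk⇔ (λ { (h , k) zero → h ; (h , k) (suc r) → k r }) (λ h → h zero , h ∘ suc))

  def-< : (x y : Fin m) → Definable {s} (λ w ρ → toℕ (ρ x) < toℕ (ρ y))
  def-< x y = (var x <' var y) by λ w ρ → mk⇔ (<ᵇ⇒< _ _) <⇒<ᵇ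

  -- Bounding the quantified number by a position makes it range over positions.
  def-∄< : {R : ∀ {n} → Vec (Fin s) (suc n) → (Fin m → Fin (suc n)) → ℕ → Set} →
    Definable {m = suc m} (λ w ρ → R w (ρ ∘ suc) (toℕ (ρ zero))) → (y : Fin m) →
    Definable (λ w ρ → ∀ u → u < toℕ (ρ y) → ¬ R w ρ u)
  def-∄< {m} {R} d y = def-resp (def-¬ bounded) (λ w ρ →
    mk⇔ (unbound w ρ) (λ h (i , i<y , r) → h (toℕ i) i<y r))
    where
    Bounded : Structural s m
    Bounded {n} w ρ = ∃ λ (i : Fin (suc n)) → toℕ i < toℕ (ρ y) × R w ρ (toℕ i)
    bounded : Definable Bounded
    bounded = def-∃ (def-× (def-< zero (suc y)) d)
    unbound : ∀ {n} (w : Vec (Fin s) (suc n)) ρ → ¬ Bounded w ρ → ∀ u → u < toℕ (ρ y) → ¬ R w ρ u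
    unbound w ρ h u u<y r = h (fromℕ< (ℕ.<-trans u<y (toℕ<n (ρ y))) ,
      subst (_< toℕ (ρ y)) (sym (toℕ-fromℕ< _)) u<y , subst (R w ρ) (sym (toℕ-fromℕ< _)) r)

-- Runs over labelled positions

act : ∀ {q k} → (Fin k → Fin q → Fin q) → Maybe (Fin k) → Fin q → Fin q
act α nothing  p = p
act α (just i) p = α i p

run : ∀ {q k} → (Fin k → Fin q → Fin q) → (ℕ → Maybe (Fin k)) → ℕ → Fin q → Fin q
run α g zero    p = p
run α g (suc y) p = act α (g y) (run α g y p)

-- Erasing the labels up to and including `x` lets a run from position 0 stand for one that starts
-- just after `x`, so a block or a suffix needs only its left end as a parameter.
mask : ∀ {k} → ℕ → (ℕ → Maybe (Fin k)) → ℕ → Maybe (Fin k)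
mask x g z = if x <ᵇ z then g z else nothing

mask-≤ : ∀ {k} {x z} {g : ℕ → Maybe (Fin k)} → z ≤ x → mask x g z ≡ nothing
mask-≤ {x = x} {z} z≤x with x <ᵇ z in eq
... | false = refl
... | true  = contradiction (<ᵇ⇒< x z (subst T (sym eq) tt)) (ℕ.≤⇒≯ z≤x)

mask-< : ∀ {k} {x z} {g : ℕ → Maybe (Fin k)} → x < z → mask x g z ≡ g z
mask-< {x = x} {z} x<z with x <ᵇ z in eq
... | true  = refl
... | false = ⊥-elim (subst T eq (<⇒<ᵇ x<z))

run-mask : ∀ {q k} (α : Fin k → Fin q → Fin q) g {x} y p → y ≤ suc x → run α (mask x g) y p ≡ p
run-mask α g zero p _ = refl
run-mask α g (suc y) p (s≤s y≤x) =
  trans (cong (λ l → act α l (run α (mask _ g) y p)) (mask-≤ {g = g} y≤x)) (run-mask α g y p (ℕ.m≤n⇒m≤1+n y≤x))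

-- Aperiodic monoids of transformations

-- The letters change during the induction but always act by members of some such class; keeping it
-- an abstract predicate lets aperiodicity pass on without a list of generators.
record AperiodicMonoid {q} (G : (Fin q → Fin q) → Set) : Set where
  field
    id∈      : G id
    ∘∈       : ∀ {f g} → G f → G g → G (g ∘ f)
    exponent : ℕ
    settles  : ∀ {f} → G f → ∀ p → fold p f exponent ≡ fold p f (suc exponent)

open AperiodicMonoid

run∈ : ∀ {q k} {G : (Fin q → Fin q) → Set} (α : Fin k → Fin q → Fin q) g → AperiodicMonoid G →
  (∀ z i → g z ≡ just i → G (α i)) → ∀ y → G (run α g y)
run∈ α g M lab zero = id∈ M
run∈ α g M lab (suc y) with g y in eq
... | nothing = run∈ α g M lab y
... | just i  = ∘∈ M (run∈ α g M lab y) (lab y i eq)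

-- Each `p` is the result of applying `f` to some `p'` `exponent` times; one more application
-- changes nothing there, so `f` fixes `p`.
surjective⇒id : ∀ {q} {G : (Fin q → Fin q) → Set} {f} → AperiodicMonoid G → G f →
  (∀ p → ∃ λ p' → f p' ≡ p) → ∀ p → f p ≡ p
surjective⇒id {f = f} M f∈ surj p with root (exponent M) p
  where
  root : ∀ n p → ∃ λ p' → fold p' f n ≡ p
  root zero    p = p , refl
  root (suc n) p with surj p
  ... | p₁ , refl with root n p₁
  ... | p₂ , refl = p₂ , refl
... | p' , refl = sym (settles M f∈ p')

-- Erased letters become `nothing`, which acts as the identity, so the remaining positions keep
-- their numbers.
deleteZero : ∀ {k} → Maybe (Fin (suc k)) → Maybe (Fin k)
deleteZero nothing        = nothing
deleteZero (just zero)    = nothing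
deleteZero (just (suc i)) = just i

deleteZero-just : ∀ {k} {l : Maybe (Fin (suc k))} {i} → deleteZero l ≡ just i ⇔ l ≡ just (suc i)
deleteZero-just {l = nothing}      = mk⇔ (λ ()) (λ ())
deleteZero-just {l = just zero}    = mk⇔ (λ ()) (λ ())
deleteZero-just {l = just (suc i)} = mk⇔ (λ { refl → refl }) (λ { refl → refl })

-- The hypothesis concerns only zeros that occur before `y`: a letter is known to act inside the
-- monoid only where it occurs, and a stretch without zeros satisfies the hypothesis vacuously.
run-deleteZero : ∀ {q k} (α : Fin (suc k) → Fin q → Fin q) g y p →
  (∀ u → u < y → g u ≡ just zero → ∀ p → α zero p ≡ p) →
  run (α ∘ suc) (deleteZero ∘ g) y p ≡ run α g y p
run-deleteZero α g zero p h = refl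
run-deleteZero α g (suc y) p h with g y in eq | run-deleteZero α g y p (λ u → h u ∘ ℕ.m≤n⇒m≤1+n)
... | nothing        | ih = ih
... | just zero      | ih = trans ih (sym (h y ℕ.≤-refl eq _))
... | just (suc i)   | ih = cong (α (suc i)) ih

-- Occurrences of the letter zero and the decomposition into blocks

module Zeros {k : ℕ} (g : ℕ → Maybe (Fin (suc k))) where

  extendSpan : Maybe (Fin (suc k)) → ℕ → Maybe (ℕ × ℕ) → Maybe (ℕ × ℕ)
  extendSpan (just zero) y nothing        = just (y , y)
  extendSpan (just zero) y (just (f , _)) = just (f , y)
  extendSpan _           y b              = b

  -- The first and the last position below the bound that are labelled zero.
  span : ℕ → Maybe (ℕ × ℕ)
  span zero    = nothing
  span (suc y) = extendSpan (g y) y (span y)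

  Free : ℕ → ℕ → Set
  Free x y = ∀ u → u < y → ¬ (x < u × g u ≡ just zero)

  NoZero : ℕ → Set
  NoZero y = ∀ u → u < y → ¬ g u ≡ just zero

  Span : ℕ → ℕ → ℕ → Set
  Span y f l = (f < y × g f ≡ just zero × NoZero f) × (l < y × g l ≡ just zero × Free l y)

  SpanSpec : ℕ → Maybe (ℕ × ℕ) → Set
  SpanSpec y nothing        = NoZero y
  SpanSpec y (just (f , l)) = Span y f l

  private
    next : ∀ {y} {P : ℕ → Set} → (∀ u → u < y → ¬ P u) → ¬ P y → ∀ u → u < suc y → ¬ P u
    next h hy u (s≤s u≤y) with ℕ.m≤n⇒m<n∨m≡n u≤y
    ... | inj₁ u<y  = h u u<y
    ... | inj₂ refl = hy

  span-spec : ∀ y → SpanSpec y (span y)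
  span-spec zero u ()
  span-spec (suc y) with g y in eq | span y | span-spec y
  ... | just zero    | nothing      | h =
    (ℕ.≤-refl , eq , h) , (ℕ.≤-refl , eq , λ { u (s≤s u≤y) (y<u , _) → ℕ.<⇒≱ y<u u≤y })
  ... | just zero    | just (f , l) | (f< , fz , fn) , _ =
    (ℕ.m≤n⇒m≤1+n f< , fz , fn) , (ℕ.≤-refl , eq , λ { u (s≤s u≤y) (y<u , _) → ℕ.<⇒≱ y<u u≤y })
  ... | just (suc i) | nothing      | h = next h (λ e → case trans (sym eq) e of λ ())
  ... | nothing      | nothing      | h = next h (λ e → case trans (sym eq) e of λ ())
  ... | just (suc i) | just (f , l) | (f< , fz , fn) , (l< , lz , ln) =
    (ℕ.m≤n⇒m≤1+n f< , fz , fn) , (ℕ.m≤n⇒m≤1+n l< , lz , next ln (λ (_ , e) → case trans (sym eq) e of λ ()))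
  ... | nothing      | just (f , l) | (f< , fz , fn) , (l< , lz , ln) =
    (ℕ.m≤n⇒m≤1+n f< , fz , fn) , (ℕ.m≤n⇒m≤1+n l< , lz , next ln (λ (_ , e) → case trans (sym eq) e of λ ()))

  -- `span` is computed by recursion, whereas `Span` is a first-order condition on `f` and `l`; they
  -- agree because the first and the last zero are unique.
  span-just : ∀ y f l → span y ≡ just (f , l) ⇔ Span y f l
  span-just y f l = mk⇔ (λ e → subst (SpanSpec y) e (span-spec y)) bwd
    where
    bwd : Span y f l → span y ≡ just (f , l)
    bwd ((f< , fz , fn) , (l< , lz , ln)) with span y | span-spec y
    ... | nothing        | h = contradiction fz (h f f<)
    ... | just (f' , l') | (f'< , f'z , f'n) , (l'< , l'z , l'n) = cong just (cong₂ _,_ f≡ l≡)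
      where
      f≡ : f' ≡ f
      f≡ with ℕ.<-cmp f' f
      ... | tri< a _ _ = contradiction f'z (fn f' a)
      ... | tri≈ _ b _ = b
      ... | tri> _ _ c = contradiction fz (f'n f c)
      l≡ : l' ≡ l
      l≡ with ℕ.<-cmp l' l
      ... | tri< a _ _ = contradiction (a , lz) (l'n l l<)
      ... | tri≈ _ b _ = b
      ... | tri> _ _ c = contradiction (c , l'z) (ln l' l'<)

Labelling : ℕ → ℕ → ℕ → Set
Labelling s m k = ∀ {n} → Vec (Fin s) (suc n) → (Fin m → Fin (suc n)) → ℕ → Maybe (Fin k)

module Blocks {q k : ℕ} (α : Fin (suc k) → Fin (suc q) → Fin (suc q))
              (hole : Fin (suc q)) (avoids : ∀ p → ¬ hole ≡ α zero p) where

  emb : Fin q → Fin (suc q)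
  emb = punchIn hole

  retract : Fin (suc q) → Fin q
  retract p = punchOut (avoids p)

  emb-retract : ∀ p → emb (retract p) ≡ α zero p
  emb-retract p = punchIn-punchOut (avoids p)

  -- Block letters are codes of all transformations of the states other than `hole`, so acting is
  -- decoding.
  β : Fin (q ^ q) → Fin q → Fin q
  β = finToFun

  module _ (g : ℕ → Maybe (Fin (suc k))) where
    open Zeros g

    g₀ : ℕ → Maybe (Fin k)
    g₀ = deleteZero ∘ g

    -- `retract` applies the closing zero: `emb (retract p)` is `α zero p`.
    block : ℕ → ℕ → Fin q → Fin q
    block l z s = retract (run (α ∘ suc) (mask l g₀) z (emb s))

    blockLabel : Maybe (Fin (suc k)) → Maybe (ℕ × ℕ) → ℕ → Maybe (Fin (q ^ q))
    blockLabel (just zero) (just (_ , l)) z = just (funToFin (block l z))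
    blockLabel _           _              z = nothing

    -- Every zero except the first is labelled with the transformation, on the states
    -- other than hole, of the block from just after the previous zero up to it.
    blocks : ℕ → Maybe (Fin (q ^ q))
    blocks z = blockLabel (g z) (span z) z

    blocks-nonzero : ∀ y → ¬ g y ≡ just zero → blocks y ≡ nothing
    blocks-nonzero y h with g y
    ... | nothing      = refl
    ... | just zero    = contradiction refl h
    ... | just (suc i) = refl

    run-blocks-noZero : ∀ y s → NoZero y → run β blocks y s ≡ s
    run-blocks-noZero zero    s h = refl
    run-blocks-noZero (suc y) s h =
      trans (cong (λ b → act β b (run β blocks y s)) (blocks-nonzero y (h y ℕ.≤-refl)))
            (run-blocks-noZero y s (λ u → h u ∘ ℕ.m≤n⇒m≤1+n))

    run-noZero : ∀ y p → NoZero y → run (α ∘ suc) g₀ y p ≡ run α g y p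
    run-noZero y p h = run-deleteZero α g y p (λ u u<y e → contradiction e (h u u<y))

    -- The stretch before the first zero may visit `hole`, so it runs on all states; the zero at its
    -- end lands among the other states, where the blocks take over.
    blockRun : ℕ → ℕ → Fin (suc q) → Fin q
    blockRun y f p = run β blocks y (retract (run (α ∘ suc) g₀ f p))

    -- Three stretches: up to the first zero, from there to the last zero, and after it. A nonzero
    -- letter extends the third; a zero turns the third into a new block and leaves a masked run
    -- that is still the identity.
    run-span : ∀ y p f l → span y ≡ just (f , l) →
      run α g y p ≡ run (α ∘ suc) (mask l g₀) y (emb (blockRun y f p))
    run-span zero    p f l ()
    run-span (suc y) p f l e = byLabel (g y) refl (span y) refl e
      where
      nonzero : ∀ c → g y ≡ c → ¬ c ≡ just zero → span y ≡ just (f , l) →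
        run α g (suc y) p ≡ run (α ∘ suc) (mask l g₀) (suc y) (emb (blockRun (suc y) f p))
      nonzero c gy c≢0 sp = begin
        act α (g y) (run α g y p)                        ≡⟨ act-deleteZero (g y) (c≢0 ∘ trans (sym gy)) ⟩
        act (α ∘ suc) (g₀ y) (run α g y p)
          ≡⟨ cong₂ (act (α ∘ suc)) (sym (mask-< {g = g₀} l<y)) (run-span y p f l sp) ⟩
        run (α ∘ suc) (mask l g₀) (suc y) (emb (blockRun y f p))
          ≡⟨ cong (λ b → run (α ∘ suc) (mask l g₀) (suc y) (emb (act β b (blockRun y f p))))
                  (blocks-nonzero y (c≢0 ∘ trans (sym gy))) ⟨
        run (α ∘ suc) (mask l g₀) (suc y) (emb (blockRun (suc y) f p)) ∎
        where
        open ≡-Reasoning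
        l<y : l < y
        l<y = proj₁ (proj₂ (to (span-just y f l) sp))
        act-deleteZero : ∀ c {p} → ¬ c ≡ just zero → act α c p ≡ act (α ∘ suc) (deleteZero c) p
        act-deleteZero nothing        _ = refl
        act-deleteZero (just zero)    h = contradiction refl h
        act-deleteZero (just (suc i)) _ = refl

      byLabel : ∀ c → g y ≡ c → ∀ b → span y ≡ b → extendSpan c y b ≡ just (f , l) →
        run α g (suc y) p ≡ run (α ∘ suc) (mask l g₀) (suc y) (emb (blockRun (suc y) f p))
      byLabel nothing        gy b sp refl = nonzero _ gy (λ ()) sp
      byLabel (just (suc i)) gy b sp refl = nonzero _ gy (λ ()) sp
      -- The first zero closes no block: `retract` inside `blockRun` applies it, and it gets no
      -- block label.
      byLabel (just zero)    gy nothing sp refl = begin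
        act α (g y) (run α g y p)                          ≡⟨ cong₂ (act α) gy (sym (run-noZero y p noZero)) ⟩
        α zero (run (α ∘ suc) g₀ y p)                      ≡⟨ emb-retract _ ⟨
        emb (retract (run (α ∘ suc) g₀ y p))               ≡⟨ cong emb (run-blocks-noZero y _ noZero) ⟨
        emb (act β nothing (blockRun y y p))        ≡⟨ cong (λ b → emb (act β b (blockRun y y p)))
                                                                   (cong₂ (λ c b → blockLabel c b y) gy sp) ⟨
        emb (blockRun (suc y) y p)                         ≡⟨ run-mask (α ∘ suc) g₀ (suc y) _ ℕ.≤-refl ⟨
        run (α ∘ suc) (mask y g₀) (suc y) (emb (blockRun (suc y) y p)) ∎
        where
        open ≡-Reasoning
        noZero : NoZero y
        noZero = subst (SpanSpec y) sp (span-spec y)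
      byLabel (just zero) gy (just (f , l')) sp refl = begin
        act α (g y) (run α g y p)                          ≡⟨ cong₂ (act α) gy (run-span y p f l' sp) ⟩
        α zero (run (α ∘ suc) (mask l' g₀) y (emb s))      ≡⟨ emb-retract _ ⟨
        emb (block l' y s)                                 ≡⟨ cong emb (finToFun-funToFin (block l' y) s) ⟨
        emb (β (funToFin (block l' y)) s)           ≡⟨ cong (λ b → emb (act β b s))
                                                                   (cong₂ (λ c b → blockLabel c b y) gy sp) ⟨
        emb (blockRun (suc y) f p)                         ≡⟨ run-mask (α ∘ suc) g₀ (suc y) _ ℕ.≤-refl ⟨
        run (α ∘ suc) (mask y g₀) (suc y) (emb (blockRun (suc y) f p)) ∎
        where
        open ≡-Reasoning
        s : Fin q
        s = blockRun y f p

    -- Equality of codes becomes pointwise equality of transformations, which finitely many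
    -- definable runs can express.
    blocks-just : ∀ z i → blocks z ≡ just i ⇔
      (g z ≡ just zero × ∃₂ λ f l → span z ≡ just (f , l) × (∀ s → block l z s ≡ β i s))
    blocks-just z i = mk⇔ (fwd (g z) (span z)) bwd
      where
      fwd : ∀ c b → blockLabel c b z ≡ just i →
        c ≡ just zero × ∃₂ λ f l → b ≡ just (f , l) × (∀ s → block l z s ≡ β i s)
      fwd (just zero) (just (f , l)) refl =
        refl , f , l , refl , λ s → sym (finToFun-funToFin (block l z) s)
      bwd : (g z ≡ just zero × ∃₂ λ f l → span z ≡ just (f , l) × (∀ s → block l z s ≡ β i s)) →
        blocks z ≡ just i
      bwd (gz , f , l , sp , h) = trans (cong₂ (λ c b → blockLabel c b z) gz sp)
        (cong just (trans (funToFin-cong h) (funToFin-finToFin {q} {q} i)))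

  blocksL : ∀ {s m} → Labelling s m (suc k) → Labelling s m (q ^ q)
  blocksL ℓ w ρ = blocks (ℓ w ρ)

  Restricts : ((Fin (suc q) → Fin (suc q)) → Set) → (Fin q → Fin q) → Set
  Restricts G τ = ∃ λ h → G h × (∀ s → h (emb s) ≡ emb (τ s))

  -- `emb` is injective and carries the powers of a restriction to those of the transformation it
  -- restricts, so the exponent is inherited.
  restrict : ∀ {G} → AperiodicMonoid G → AperiodicMonoid (Restricts G)
  restrict M .id∈ = id , id∈ M , λ _ → refl
  restrict M .∘∈ {f} {g} (f' , f∈ , ef) (g' , g∈ , eg) =
    g' ∘ f' , ∘∈ M f∈ g∈ , λ s → trans (cong g' (ef s)) (eg (f s))
  restrict M .exponent = exponent M
  restrict M .settles {f} (f' , f∈ , ef) s =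
    punchIn-injective hole _ _
      (trans (sym (emb-fold (exponent M))) (trans (settles M f∈ (emb s)) (emb-fold (suc (exponent M)))))
    where
    emb-fold : ∀ n → fold (emb s) f' n ≡ emb (fold s f n)
    emb-fold zero    = refl
    emb-fold (suc n) = trans (cong f' (emb-fold n)) (ef (fold s f n))

  -- A block is a product of letters that ends with a zero, and this last letter brings every state
  -- back into the image of `emb`.
  blocks∈ : ∀ {G} g → AperiodicMonoid G → (∀ z i → g z ≡ just i → G (α i)) →
    ∀ z i → blocks g z ≡ just i → Restricts G (β i)
  blocks∈ g M lab z i e with to (blocks-just g z i) e
  ... | gz , f , l , _ , eq = _ ,
    ∘∈ M (run∈ (α ∘ suc) (mask l (g₀ g)) M mask-lab z) (lab z zero gz) ,
    λ s → trans (sym (emb-retract _)) (cong emb (eq s))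
    where
    mask-lab : ∀ u j → mask l (g₀ g) u ≡ just j → _
    mask-lab u j h with l <ᵇ u
    ... | true = lab u (suc j) (to deleteZero-just h)

-- Definability is required in every context σ, so that a labelling can be used below
-- further quantifiers without renaming formulas.
DefinableLabelling : ∀ {s m k} → Labelling s m k → Set
DefinableLabelling {m = m} {k} ℓ = ∀ {m'} (σ : Fin m → Fin m') (z : Fin m') (i : Fin k) →
  Definable (λ w ρ → ℓ w (ρ ∘ σ) (toℕ (ρ z)) ≡ just i)

DefinableRun : ∀ {s m k q} → (Fin k → Fin q → Fin q) → Labelling s m k → Set
DefinableRun {m = m} {q = q} α ℓ = ∀ {m'} (σ : Fin m → Fin m') (y : Fin m') (p p' : Fin q) →
  Definable (λ w ρ → run α (ℓ w (ρ ∘ σ)) (toℕ (ρ y)) p ≡ p')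

-- Definability of masks, spans and blocks

module _ {s m k : ℕ} where

  maskL : Labelling s m k → Labelling s (suc m) k
  maskL ℓ w ρ = mask (toℕ (ρ zero)) (ℓ w (ρ ∘ suc))

  def-mask : (ℓ : Labelling s m k) → DefinableLabelling ℓ → DefinableLabelling (maskL ℓ)
  def-mask ℓ d σ z i = def-resp (def-× (def-< (σ zero) z) (d (σ ∘ suc) z i)) (λ w ρ →
    mk⇔ (λ (h , e) → trans (mask-< {g = ℓ w (ρ ∘ σ ∘ suc)} h) e)
        (λ e → case ℕ.<-≤-connex (toℕ (ρ (σ zero))) (toℕ (ρ z)) of λ where
          (inj₁ h) → h , trans (sym (mask-< {g = ℓ w (ρ ∘ σ ∘ suc)} h)) e
          (inj₂ h) → case trans (sym e) (mask-≤ {g = ℓ w (ρ ∘ σ ∘ suc)} h) of λ ()))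

-- Substitution of a finite-valued definable function: a finite disjunction guesses its value `r`.
def-cases : ∀ {s m q} (t : ∀ {n} → Vec (Fin s) (suc n) → (Fin m → Fin (suc n)) → Fin q) →
  (R : Fin q → Structural s m) → (∀ r → Definable (λ w ρ → t w ρ ≡ r)) → (∀ r → Definable (R r)) →
  Definable (λ w ρ → R (t w ρ) w ρ)
def-cases t R dt dR = def-resp (def-∃Fin (λ r → def-× (dt r) (dR r))) (λ w ρ →
  mk⇔ (λ { (_ , refl , h) → h }) (λ h → t w ρ , refl , h))

deleteZeroL : ∀ {s m k} → Labelling s m (suc k) → Labelling s m k
deleteZeroL ℓ w ρ = deleteZero ∘ ℓ w ρ

module _ {s m k : ℕ} (ℓ : Labelling s m (suc k)) (dℓ : DefinableLabelling ℓ) where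
  open Zeros

  def-deleteZero : DefinableLabelling (deleteZeroL ℓ)
  def-deleteZero σ z i = def-resp (dℓ σ z (suc i))
    (λ w ρ → mk⇔ (from deleteZero-just) (to deleteZero-just))

  module _ {m'} (σ : Fin m → Fin m') where

    def-noZero : ∀ y → Definable (λ w ρ → NoZero (ℓ w (ρ ∘ σ)) (toℕ (ρ y)))
    def-noZero = def-∄< {R = λ w ρ u → ℓ w (ρ ∘ σ) u ≡ just zero} (dℓ (suc ∘ σ) zero zero)

    def-free : ∀ x y → Definable (λ w ρ → Free (ℓ w (ρ ∘ σ)) (toℕ (ρ x)) (toℕ (ρ y)))
    def-free x = def-∄< {R = λ w ρ u → toℕ (ρ x) < u × ℓ w (ρ ∘ σ) u ≡ just zero}
      (def-× (def-< (suc x) zero) (dℓ (suc ∘ σ) zero zero))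

    def-span : ∀ y f l →
      Definable (λ w ρ → span (ℓ w (ρ ∘ σ)) (toℕ (ρ y)) ≡ just (toℕ (ρ f) , toℕ (ρ l)))
    def-span y f l = def-resp
      (def-× (def-× (def-< f y) (def-× (dℓ σ f zero) (def-noZero f)))
             (def-× (def-< l y) (def-× (dℓ σ l zero) (def-free l y))))
      (λ w ρ → mk⇔ (from (span-just (ℓ w (ρ ∘ σ)) _ _ _)) (to (span-just (ℓ w (ρ ∘ σ)) _ _ _)))

  -- The quantified numbers can be taken to be positions, since `Span` puts both below the position
  -- `y`.
  def-∃span : ∀ {m'} (σ : Fin m → Fin m') y
    (R : ∀ {n} → Vec (Fin s) (suc n) → (Fin m' → Fin (suc n)) → ℕ → ℕ → Set) →
    Definable {m = suc (suc m')} (λ w ρ → R w (ρ ∘ suc²) (toℕ (ρ (suc zero))) (toℕ (ρ zero))) →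
    Definable (λ w ρ → ∃₂ λ f l → span (ℓ w (ρ ∘ σ)) (toℕ (ρ y)) ≡ just (f , l) × R w ρ f l)
  def-∃span {m'} σ y R d = def-resp positions (λ w ρ →
    mk⇔ (λ (f , l , h) → toℕ f , toℕ l , h) (λ (f , l , h) → atPositions w ρ f l h))
    where
    Body : ∀ {n} → Vec (Fin s) (suc n) → (Fin m' → Fin (suc n)) → ℕ → ℕ → Set
    Body w ρ f l = span (ℓ w (ρ ∘ σ)) (toℕ (ρ y)) ≡ just (f , l) × R w ρ f l
    AtPositions : Structural s m'
    AtPositions {n} w ρ = ∃₂ λ (f l : Fin (suc n)) → Body w ρ (toℕ f) (toℕ l)
    positions : Definable AtPositions
    positions = def-∃ (def-∃ (def-× (def-span (suc² ∘ σ) (suc² y) (suc zero) zero) d))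
    atPositions : ∀ {n} (w : Vec (Fin s) (suc n)) ρ f l → Body w ρ f l → AtPositions w ρ
    atPositions w ρ f l h@(sp , _) with to (span-just (ℓ w (ρ ∘ σ)) _ f l) sp
    ... | (f< , _) , (l< , _) = fromℕ< (below f<) , fromℕ< (below l<) ,
      subst₂ (Body w ρ) (sym (toℕ-fromℕ< (below f<))) (sym (toℕ-fromℕ< (below l<))) h
      where
      below : ∀ {u} → u < toℕ (ρ y) → u < _
      below u<y = ℕ.<-trans u<y (toℕ<n (ρ y))

  module _ {q : ℕ} (α : Fin (suc k) → Fin (suc q) → Fin (suc q))
           (hole : Fin (suc q)) (avoids : ∀ p → ¬ hole ≡ α zero p)
           (d-masked : DefinableRun (α ∘ suc) (maskL (deleteZeroL ℓ))) where
    open Blocks α hole avoids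

    def-blocks : DefinableLabelling (blocksL ℓ)
    def-blocks σ z i = def-resp
      (def-× (dℓ σ z zero)
             (def-∃span σ z (λ w ρ f l → ∀ r → block (ℓ w (ρ ∘ σ)) l (toℕ (ρ z)) r ≡ β i r)
               (def-∀Fin λ r → def-cases _ (λ p w ρ → retract p ≡ β i r)
                 -- The two quantifiers bind `f` as variable one and `l` as variable zero; the mask
                 -- starts at `l`.
                 (d-masked (extend zero (suc² ∘ σ)) (suc (suc z)) (emb r))
                 (λ p → def-dec (retract p ≟ β i r)))))
      (λ w ρ → mk⇔ (from (blocks-just (ℓ w (ρ ∘ σ)) (toℕ (ρ z)) i))
                   (to (blocks-just (ℓ w (ρ ∘ σ)) (toℕ (ρ z)) i)))

    -- `DefinableRun` speaks of runs from a fixed state, so the states that link the three stretches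
    -- of `run-span` are guessed, one `def-cases` for each link.
    def-run-blocks : DefinableRun (α ∘ suc) (deleteZeroL ℓ) → DefinableRun β (blocksL ℓ) → DefinableRun α ℓ
    def-run-blocks d-zeroFree d-blocks {m'} σ y p p' = def-resp
      (def-⊎ (def-× (def-noZero σ y) (d-zeroFree σ y p p'))
             (def-∃span σ y After
               (def-cases _
                 (λ r w ρ →
                   masked w ρ (emb (run β (blocksL ℓ w (ρ ∘ suc² ∘ σ)) (toℕ (ρ (suc² y))) (retract r))) ≡ p')
                 (d-zeroFree (suc² ∘ σ) (suc zero) p)
                 λ r → def-cases _ (λ r' w ρ → masked w ρ (emb r') ≡ p')
                   (d-blocks (suc² ∘ σ) (suc² y) (retract r))
                   (λ r' → d-masked σ² (suc² y) (emb r') p'))))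
      (λ w ρ → mk⇔ (sound w ρ) (complete w ρ))
      where
      σ² : Fin (suc m) → Fin (suc (suc m'))
      σ² = extend zero (suc² ∘ σ)

      masked : ∀ {n} → Vec (Fin s) (suc n) → (Fin (suc (suc m')) → Fin (suc n)) → Fin (suc q) → Fin (suc q)
      masked w ρ = run (α ∘ suc) (maskL (deleteZeroL ℓ) w (ρ ∘ σ²)) (toℕ (ρ (suc² y)))

      After : ∀ {n} → Vec (Fin s) (suc n) → (Fin m' → Fin (suc n)) → ℕ → ℕ → Set
      After w ρ f l = let g = ℓ w (ρ ∘ σ) in
        run (α ∘ suc) (mask l (g₀ g)) (toℕ (ρ y)) (emb (blockRun g (toℕ (ρ y)) f p)) ≡ p'

      Split : Structural s m'
      Split w ρ = let g = ℓ w (ρ ∘ σ) in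
        NoZero g (toℕ (ρ y)) × run (α ∘ suc) (g₀ g) (toℕ (ρ y)) p ≡ p'
        ⊎ ∃₂ λ f l → span g (toℕ (ρ y)) ≡ just (f , l) × After w ρ f l

      sound : ∀ {n} (w : Vec (Fin s) (suc n)) ρ → Split w ρ → run α (ℓ w (ρ ∘ σ)) (toℕ (ρ y)) p ≡ p'
      sound w ρ (inj₁ (h , e))           = trans (sym (run-noZero (ℓ w (ρ ∘ σ)) (toℕ (ρ y)) p h)) e
      sound w ρ (inj₂ (f , l , sp , e)) = trans (run-span (ℓ w (ρ ∘ σ)) (toℕ (ρ y)) p f l sp) e

      complete : ∀ {n} (w : Vec (Fin s) (suc n)) ρ → run α (ℓ w (ρ ∘ σ)) (toℕ (ρ y)) p ≡ p' → Split w ρ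
      complete w ρ e with span (ℓ w (ρ ∘ σ)) (toℕ (ρ y)) in sp
      ... | just (f , l) = inj₂ (f , l , refl , trans (sym (run-span (ℓ w (ρ ∘ σ)) (toℕ (ρ y)) p f l sp)) e)
      ... | nothing = inj₁ (h , trans (run-noZero (ℓ w (ρ ∘ σ)) (toℕ (ρ y)) p h) e)
        where
        h : NoZero (ℓ w (ρ ∘ σ)) (toℕ (ρ y))
        h = subst (SpanSpec (ℓ w (ρ ∘ σ)) (toℕ (ρ y))) sp (span-spec (ℓ w (ρ ∘ σ)) (toℕ (ρ y)))

-- The induction on states and letters

RunsDefinable : ℕ → ℕ → Set₁
RunsDefinable q k = ∀ {s m} (α : Fin k → Fin q → Fin q) (ℓ : Labelling s m k)
  {G : (Fin q → Fin q) → Set} → AperiodicMonoid G →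
  (∀ {n} (w : Vec (Fin s) (suc n)) ρ z i → ℓ w ρ z ≡ just i → G (α i)) →
  DefinableLabelling ℓ → DefinableRun α ℓ

runs-unlabelled : ∀ {q} → RunsDefinable q 0
runs-unlabelled α ℓ M lab dℓ σ y p p' = def-resp (def-dec (p ≟ p')) (λ w ρ →
  let e = stays (ℓ w (ρ ∘ σ)) (toℕ (ρ y)) in mk⇔ (trans e) (trans (sym e)))
  where
  stays : ∀ g y → run α g y p ≡ p
  stays g zero    = refl
  stays g (suc y) with g y
  ... | nothing = stays g y

-- The hypothesis on fewer states covers every number of letters, because blocks use `q ^ q` of
-- them. The runs inside blocks keep all states but lose the letter zero.
runs-step : ∀ {q k} → (∀ k → RunsDefinable q k) → RunsDefinable (suc q) k → RunsDefinable (suc q) (suc k)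
runs-step {q} {k} fewerStates fewerLetters α ℓ {G} M lab dℓ
  with all? (λ r → any? (λ p → α zero p ≟ r))
... | yes surj = λ σ y p p' → def-resp (zeroFree σ y p p') (λ w ρ →
    let e = run-deleteZero α (ℓ w (ρ ∘ σ)) (toℕ (ρ y)) p
              (λ u _ gu → surjective⇒id M (lab w (ρ ∘ σ) u zero gu) surj)
    in mk⇔ (trans (sym e)) (trans e))
  where
  zeroFree : DefinableRun (α ∘ suc) (deleteZeroL ℓ)
  zeroFree = fewerLetters (α ∘ suc) (deleteZeroL ℓ) M
    (λ w ρ z i → lab w ρ z (suc i) ∘ to deleteZero-just) (def-deleteZero ℓ dℓ)
... | no ¬surj with ¬∀⟶∃¬ _ _ (λ r → any? (λ p → α zero p ≟ r)) ¬surj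
... | hole , ¬hit = def-run-blocks ℓ dℓ α hole avoids masked
  (fewerLetters (α ∘ suc) ℓ₀ M lab₀ (def-deleteZero ℓ dℓ))
  (fewerStates (q ^ q) β (blocksL ℓ) (restrict M)
    (λ w ρ → blocks∈ (ℓ w ρ) M (lab w ρ)) (def-blocks ℓ dℓ α hole avoids masked))
  where
  avoids : ∀ p → ¬ hole ≡ α zero p
  avoids p e = ¬hit (p , sym e)
  open Blocks α hole avoids
  ℓ₀ : Labelling _ _ k
  ℓ₀ = deleteZeroL ℓ
  lab₀ : ∀ {n} (w : Vec (Fin _) (suc n)) ρ z i → ℓ₀ w ρ z ≡ just i → G (α (suc i))
  lab₀ w ρ z i = lab w ρ z (suc i) ∘ to deleteZero-just
  lab-mask : ∀ {n} (w : Vec (Fin _) (suc n)) ρ z i → maskL ℓ₀ w ρ z ≡ just i → G (α (suc i))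
  lab-mask w ρ z i e with toℕ (ρ zero) <ᵇ z
  ... | true = lab₀ w (ρ ∘ suc) z i e
  masked : DefinableRun (α ∘ suc) (maskL ℓ₀)
  masked = fewerLetters (α ∘ suc) (maskL ℓ₀) M lab-mask (def-mask ℓ₀ (def-deleteZero ℓ dℓ))

runs-definable : ∀ q k → RunsDefinable q k
runs-definable zero    k       α ℓ M lab dℓ σ y ()
runs-definable (suc q) zero    = runs-unlabelled
runs-definable (suc q) (suc k) = runs-step (runs-definable q) (runs-definable (suc q) k)

-- From transducers to formulas

-- Sets are coded as numbers so that they can be states, and so that sets with the same members are
-- equal (`subset-ext`).
Subset : ℕ → Set
Subset n = Fin (2 ^ n)

module _ {n : ℕ} where

  infix 4 _∈_ _∈?_

  bits : Subset n → Fin n → Fin 2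
  bits = finToFun

  _∈_ : Fin n → Subset n → Set
  x ∈ S = bits S x ≡ suc zero

  _∈?_ : ∀ x S → Dec (x ∈ S)
  x ∈? S = bits S x ≟ suc zero

  bit : {A : Set} → Dec A → Fin 2
  bit (yes _) = suc zero
  bit (no _)  = zero

  bit-one : {A : Set} (a? : Dec A) → bit a? ≡ suc zero ⇔ A
  bit-one (yes a) = mk⇔ (λ _ → a) (λ _ → refl)
  bit-one (no ¬a) = mk⇔ (λ ()) (λ a → contradiction a ¬a)

  module _ {P : Fin n → Set} (P? : ∀ x → Dec (P x)) where

    subset : Subset n
    subset = funToFin (bit ∘ P?)

    ∈-subset : ∀ x → x ∈ subset ⇔ P x
    ∈-subset x = mk⇔ (to (bit-one (P? x)) ∘ trans (sym e)) (trans e ∘ from (bit-one (P? x)))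
      where
      e : bits subset x ≡ bit (P? x)
      e = finToFun-funToFin (bit ∘ P?) x

  subset-ext : ∀ {S S' : Subset n} → (∀ x → x ∈ S ⇔ x ∈ S') → S ≡ S'
  subset-ext {S} {S'} h = trans (sym (funToFin-finToFin {n} {2} S))
    (trans (funToFin-cong (λ x → bit-ext (bits S x) (bits S' x) (h x))) (funToFin-finToFin {n} {2} S'))
    where
    bit-ext : ∀ (b c : Fin 2) → (b ≡ suc zero ⇔ c ≡ suc zero) → b ≡ c
    bit-ext zero       zero       e = refl
    bit-ext (suc zero) c          e = sym (to e refl)
    bit-ext zero       (suc zero) e = from e refl

  singleton : Fin n → Subset n
  singleton p = subset (_≟ p)

fold-suc : ∀ {A : Set} (f : A → A) n x → fold (f x) f n ≡ f (fold x f n)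
fold-suc f zero    x = refl
fold-suc f (suc n) x = cong f (fold-suc f n x)

_^^_ : {A : Set} → List A → ℕ → List A
u ^^ n = concat (replicate n u)

letterAt : ∀ {k n} → Vec (Fin k) n → ℕ → Maybe (Fin k)
letterAt Vec.[]        _       = nothing
letterAt (a Vec.∷ w) zero    = just a
letterAt (a Vec.∷ w) (suc z) = letterAt w z

letterAt-lookup : ∀ {k n} (w : Vec (Fin k) n) i → letterAt w (toℕ i) ≡ just (lookup w i)
letterAt-lookup (a Vec.∷ w) zero    = refl
letterAt-lookup (a Vec.∷ w) (suc i) = letterAt-lookup w i

-- `run` recurses on its last letter and lists on their first; this mediates between the two.
run-suc : ∀ {q k} (α : Fin k → Fin q → Fin q) g y p → run α g (suc y) p ≡ run α (g ∘ suc) y (act α (g 0) p)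
run-suc α g zero    p = refl
run-suc α g (suc y) p = cong (act α (g (suc y))) (run-suc α g y p)

module _ {q k} (α : Fin k → Fin q → Fin q) where

  actions : List (Fin k) → Fin q → Fin q
  actions u p = foldl (λ p a → α a p) p u

  run-all : ∀ w p → run α (letterAt (fromList w)) (length w) p ≡ actions w p
  run-all []      p = refl
  run-all (a ∷ w) p = trans (run-suc α (letterAt (fromList (a ∷ w))) (length w) p) (run-all w (α a p))

  run-prefix : ∀ w (i : Fin (length w)) p →
    run α (letterAt (fromList w)) (toℕ i) p ≡ actions (take (toℕ i) w) p
  run-prefix (a ∷ w) zero    p = refl
  run-prefix (a ∷ w) (suc i) p =
    trans (run-suc α (letterAt (fromList (a ∷ w))) (toℕ i) p) (run-prefix w i (α a p))

  run-suffix : ∀ w (i : Fin (length w)) p →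
    run α (mask (toℕ i) (letterAt (fromList w))) (length w) p ≡ actions (drop (suc (toℕ i)) w) p
  run-suffix (a ∷ w) zero    p =
    trans (run-suc α (mask 0 (letterAt (fromList (a ∷ w)))) (length w) p) (run-all w p)
  run-suffix (a ∷ w) (suc i) p =
    trans (run-suc α (mask (suc (toℕ i)) (letterAt (fromList (a ∷ w)))) (length w) p) (run-suffix w i p)

def-max : ∀ {s m} (y : Fin m) → Definable {s} {m} (λ {n} w ρ → toℕ (ρ y) ≡ n)
def-max y = (var y ≐ tmax) by λ {n} w ρ →
  mk⇔ (λ h → trans (≡ᵇ⇒≡ (toℕ (ρ y)) _ h) (toℕ-fromℕ n))
      (λ h → ≡⇒≡ᵇ (toℕ (ρ y)) _ (trans h (sym (toℕ-fromℕ n))))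

-- The last letter has no formula: it is the value exactly when every `p j` fails, hence `inject₁`.
pick-unique : ∀ {t} (p : Fin t → Bool) b → (∀ j → T (p j) ⇔ b ≡ inject₁ j) → pick p ≡ b
pick-unique {zero}  p zero h = refl
pick-unique {suc t} p b h with p zero | h zero
... | true  | e = sym (to e tt)
pick-unique {suc t} p zero h    | false | e = ⊥-elim (from e refl)
pick-unique {suc t} p (suc b) h | false | e =
  cong suc (pick-unique (p ∘ suc) b (λ j → mk⇔ (suc-injective ∘ to (h (suc j))) (from (h (suc j)) ∘ cong suc)))

-- The subset automaton of a transducer

module FromTransducer {s t : ℕ} (M : Transducer s t) where
  open Transducer M

  Post : Fin s → Subset nQ → Fin nQ → Set
  Post a S p' = ∃ λ p → p ∈ S × ∃ λ b → T (δ p a b p')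

  Post? : ∀ a S p' → Dec (Post a S p')
  Post? a S p' = any? λ p → p ∈? S ×-dec any? λ b → T? (δ p a b p')

  post : Fin s → Subset nQ → Subset nQ
  post a S = subset (Post? a S)

  reached : Word s → Subset nQ → Subset nQ
  reached = actions post

  ∈-reached : ∀ u S p' → p' ∈ reached u S ⇔ (∃ λ p → p ∈ S × Reach M p u p')
  ∈-reached []      S p' = mk⇔ (λ h → p' , h , [] , done) (λ { (p , h , .[] , done) → h })
  ∈-reached (a ∷ u) S p' = mk⇔ fwd bwd
    where
    fwd : p' ∈ reached u (post a S) → ∃ λ p → p ∈ S × Reach M p (a ∷ u) p'
    fwd h with to (∈-reached u (post a S) p') h
    ... | p₁ , h₁ , v , r with to (∈-subset (Post? a S) p₁) h₁
    ... | p , h₀ , b , d = p , h₀ , b ∷ v , step d r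
    bwd : (∃ λ p → p ∈ S × Reach M p (a ∷ u) p') → p' ∈ reached u (post a S)
    bwd (p , h₀ , b ∷ v , step {p' = p₁} d r) = from (∈-reached u (post a S) p')
      (p₁ , from (∈-subset (Post? a S) p₁) (p , h₀ , b , d) , v , r)

  ∈-reached-singleton : ∀ u p p' → p' ∈ reached u (singleton p) ⇔ Reach M p u p'
  ∈-reached-singleton u p p' = mk⇔
    (λ h → case to (∈-reached u (singleton p) p') h of λ (p₀ , h₀ , r) →
      subst (λ x → Reach M x u p') (to (∈-subset (_≟ p) p₀) h₀) r)
    (λ r → from (∈-reached u (singleton p) p') (p , from (∈-subset (_≟ p) p) refl , r))

  Reached : (Subset nQ → Subset nQ) → Set
  Reached f = ∃ λ u → ∀ S → f S ≡ reached u S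

  -- `reached u` sends a set to the union of what its members reach, so aperiodicity of `M`, stated
  -- for single states, holds for sets with the same `N`.
  reached-monoid : Aperiodic M → AperiodicMonoid Reached
  reached-monoid ap .id∈ = [] , λ _ → refl
  reached-monoid ap .∘∈ {f} {g} (u , hu) (v , hv) = u ++ v , λ S →
    trans (trans (cong g (hu S)) (hv (reached u S))) (sym (foldl-++ (λ S a → post a S) S u v))
  reached-monoid ap .exponent = proj₁ ap
  reached-monoid (N , ap) .settles {f} (u , hu) S =
    trans (fold-reached N S) (trans (subset-ext same) (sym (fold-reached (suc N) S)))
    where
    fold-reached : ∀ n S → fold S f n ≡ reached (u ^^ n) S
    fold-reached zero    S = refl
    fold-reached (suc n) S = begin
      f (fold S f n)                   ≡⟨ fold-suc f n S ⟨
      fold (f S) f n                   ≡⟨ cong (λ S → fold S f n) (hu S) ⟩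
      fold (reached u S) f n           ≡⟨ fold-reached n (reached u S) ⟩
      reached (u ^^ n) (reached u S)   ≡⟨ foldl-++ (λ S a → post a S) S u (u ^^ n) ⟨
      reached (u ++ u ^^ n) S          ∎
      where open ≡-Reasoning
    same : ∀ p' → p' ∈ reached (u ^^ N) S ⇔ p' ∈ reached (u ^^ suc N) S
    same p' = mk⇔
      (λ h → let p , h₀ , r = to (∈-reached (u ^^ N) S p') h in
        from (∈-reached (u ^^ suc N) S p') (p , h₀ , to (ap p u p') r))
      (λ h → let p , h₀ , r = to (∈-reached (u ^^ suc N) S p') h in
        from (∈-reached (u ^^ N) S p') (p , h₀ , from (ap p u p') r))

  Accepting : Subset nQ → Set
  Accepting S = ∃ λ p → p ∈ S × T (F p)

  accepting? : ∀ S → Dec (Accepting S)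
  accepting? S = any? λ p → p ∈? S ×-dec T? (F p)

  letters : Labelling s 0 s
  letters w _ = letterAt w

  def-letters : DefinableLabelling letters
  def-letters σ z a = (P a (var z)) by λ w ρ → mk⇔
    (λ h → trans (letterAt-lookup w (ρ z)) (cong just (toWitness h)))
    (λ e → fromWitness (just-injective (trans (sym (letterAt-lookup w (ρ z))) e)))

  -- Some accepting run writes `b` here. Masking the prefix and the position itself leaves the
  -- subset run of the suffix from `p'`.
  OutputAt : Fin (suc t) → Structural s 1
  OutputAt b {n} w ρ = ∃₂ λ p p' →
    (∃ λ a → letterAt w (toℕ (ρ zero)) ≡ just a × T (δ p a b p')) ×
    p ∈ run post (letterAt w) (toℕ (ρ zero)) (singleton q₀) ×
    Accepting (run post (mask (toℕ (ρ zero)) (letterAt w)) (suc n) (singleton p'))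

  module _ (ap : Aperiodic M) where

    def-run-letters : DefinableRun post letters
    def-run-letters = runs-definable _ _ post letters (reached-monoid ap)
      (λ _ _ _ a _ → [ a ] , λ _ → refl) def-letters

    def-run-masked : DefinableRun post (maskL letters)
    def-run-masked = runs-definable _ _ post (maskL letters) (reached-monoid ap)
      (λ _ _ _ a _ → [ a ] , λ _ → refl) (def-mask letters def-letters)

    label : ∀ {n} → Vec (Fin s) (suc n) → (Fin 2 → Fin (suc n)) → Maybe (Fin s)
    label w ρ = mask (toℕ (ρ (suc zero))) (letterAt w) (toℕ (ρ zero))

    -- A definable run stops just before a position, so the letter at the last position has to be
    -- applied separately.
    def-accepting-act : ∀ S → Definable (λ w ρ → Accepting (act post (label w ρ) S))
    def-accepting-act S = def-resp
      (def-⊎ (def-∃Fin λ a → def-× (def-label a) (def-dec (accepting? (post a S))))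
             (def-× (def-¬ (def-∃Fin def-label)) (def-dec (accepting? S))))
      (λ w ρ → by-label (label w ρ))
      where
      def-label : ∀ a → Definable (λ w ρ → label w ρ ≡ just a)
      def-label = def-mask letters def-letters (λ _ → suc zero) zero
      by-label : ∀ l →
        ((∃ λ a → l ≡ just a × Accepting (post a S)) ⊎ (¬ (∃ λ a → l ≡ just a) × Accepting S)) ⇔
        Accepting (act post l S)
      by-label nothing  = mk⇔ (λ { (inj₁ (_ , () , _)) ; (inj₂ (_ , h)) → h }) (λ h → inj₂ ((λ ()) , h))
      by-label (just a) = mk⇔ (λ { (inj₁ (_ , refl , h)) → h ; (inj₂ (h , _)) → ⊥-elim (h (a , refl)) })
                              (λ h → inj₁ (a , refl , h))

    Suffix : Fin nQ → ∀ {n} → Vec (Fin s) (suc n) → (Fin 1 → Fin (suc n)) → ℕ → Set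
    Suffix p' w ρ y = Accepting (run post (mask (toℕ (ρ zero)) (letterAt w)) (suc y) (singleton p'))

    def-suffix : ∀ p' → Definable (λ {n} w ρ → Suffix p' w ρ n)
    def-suffix p' = def-resp
      (def-∃ {R = λ {n} w ρ y → toℕ y ≡ n × Suffix p' w ρ (toℕ y)}
        (def-× (def-max zero)
          (def-cases _ (λ S w ρ → Accepting (act post (label w ρ) S))
            (def-run-masked (λ _ → suc zero) zero (singleton p')) def-accepting-act)))
      (λ {n} w ρ → mk⇔ (λ (y , e , h) → subst (Suffix p' w ρ) e h)
                        (λ h → fromℕ n , toℕ-fromℕ n , subst (Suffix p' w ρ) (sym (toℕ-fromℕ n)) h))

    def-output : ∀ b → Definable (OutputAt b)
    def-output b = def-∃Fin λ p → def-∃Fin λ p' →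
      def-× (def-∃Fin λ a → def-× (def-letters (λ ()) zero a) (def-dec (T? (δ p a b p'))))
     (def-× (def-cases _ (λ S _ _ → p ∈ S) (def-run-letters (λ ()) zero (singleton q₀)) (λ S → def-dec (p ∈? S)))
            (def-suffix p'))

  at : Word (suc t) → ℕ → Maybe (Fin (suc t))
  at v = letterAt (fromList v)

  -- The part of a run around position i, with the outputs elsewhere forgotten.
  Passes : (w : Word s) → Fin (length w) → Fin nQ → Fin nQ → Fin (suc t) → Set
  Passes w i p p'' b = ∃₂ λ p₁ p₂ →
    (∃ λ a → letterAt (fromList w) (toℕ i) ≡ just a × T (δ p₁ a b p₂)) ×
    Reach M p (take (toℕ i) w) p₁ × Reach M p₂ (drop (suc (toℕ i)) w) p''

  run-split : ∀ {p w v p''} → Run M p w v p'' → ∀ i → ∃ λ b → at v (toℕ i) ≡ just b × Passes w i p p'' b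
  run-split (step {a = a} {b} d r) zero = b , refl , _ , _ , (a , refl , d) , ([] , done) , (_ , r)
  run-split (step d r) (suc i) with run-split r i
  ... | b , e , p₁ , p₂ , mid , (u , r₁) , rest = b , e , p₁ , p₂ , mid , (_ ∷ u , step d r₁) , rest

  run-join : ∀ w i {p p'' b} → Passes w i p p'' b → ∃ λ v → Run M p w v p'' × at v (toℕ i) ≡ just b
  run-join (a ∷ w) zero    (_ , _ , (_ , refl , d) , (_ , done) , (v , r)) = _ ∷ v , step d r , refl
  run-join (a ∷ w) (suc i) (p₁ , p₂ , mid , (c ∷ u , step d r₁) , rest)
    with run-join w i (p₁ , p₂ , mid , (u , r₁) , rest)
  ... | v , r , e = c ∷ v , step d r , e

  run-tabulate : ∀ {p w v p''} → Run M p w v p'' → (out : Fin (length w) → Fin (suc t)) →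
    (∀ i → at v (toℕ i) ≡ just (out i)) → v ≡ toList (Vec.tabulate out)
  run-tabulate done       out h = refl
  run-tabulate (step d r) out h =
    cong₂ _∷_ (just-injective (h zero)) (run-tabulate r (out ∘ suc) (h ∘ suc))

  OutputAt-passes : ∀ b a u (i : Fin (suc (length u))) →
    OutputAt b (fromList (a ∷ u)) (λ _ → i) ⇔ (∃ λ p'' → Passes (a ∷ u) i q₀ p'' b × T (F p''))
  OutputAt-passes b a u i = mk⇔
    (λ (p , p' , mid , pre , p'' , suf , f) → p'' ,
      (p , p' , mid , to (∈-reached-singleton _ q₀ p) (subst (p ∈_) (run-prefix post (a ∷ u) i _) pre) ,
                      to (∈-reached-singleton _ p' p'') (subst (p'' ∈_) (run-suffix post (a ∷ u) i _) suf)) , f)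
    (λ (p'' , (p , p' , mid , pre , suf) , f) → p , p' , mid ,
      subst (p ∈_) (sym (run-prefix post (a ∷ u) i _)) (from (∈-reached-singleton _ q₀ p) pre) , p'' ,
      subst (p'' ∈_) (sym (run-suffix post (a ∷ u) i _)) (from (∈-reached-singleton _ p' p'') suf) , f)

  module _ {f : Word s → Word (suc t)} (defines : Defines M f) (φs : Vec (Formula s 1) t)
           (φs-correct : ∀ j {n} (w : Vec (Fin s) (suc n)) ρ →
             T (sat w (lookup φs j) ρ) ⇔ OutputAt (inject₁ j) w ρ) where

    translates : ∀ w → f w ≡ translate φs w
    translates [] with f [] | defines []
    ... | .[] | (_ , done , _) , _ = refl
    translates (a ∷ u) with defines (a ∷ u)
    ... | (p'' , r , acc) , unique = run-tabulate r out atOut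
      where
      w : Vec (Fin s) (suc (length u))
      w = fromList (a ∷ u)
      out : Fin (suc (length u)) → Fin (suc t)
      out i = pick (λ j → sat w (lookup φs j) (λ _ → i))
      atOut : ∀ i → at (f (a ∷ u)) (toℕ i) ≡ just (out i)
      atOut i with run-split r i
      ... | b , e , passes = trans e (cong just (sym (pick-unique _ b λ j → mk⇔ (sound j) (complete j))))
        where
        sound : ∀ j → T (sat w (lookup φs j) (λ _ → i)) → b ≡ inject₁ j
        sound j h with to (OutputAt-passes (inject₁ j) a u i) (to (φs-correct j w _) h)
        ... | p₃ , passes' , acc' with run-join (a ∷ u) i passes'
        -- By `unique` this other accepting run also writes `f (a ∷ u)`, so the two runs agree on
        -- the letter at `i`.
        ... | v , r' , e' = just-injective
          (trans (sym e) (trans (cong (λ v → at v (toℕ i)) (sym (unique v (p₃ , r' , acc')))) e'))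
        complete : ∀ j → b ≡ inject₁ j → T (sat w (lookup φs j) (λ _ → i))
        complete j refl = from (φs-correct j w _) (from (OutputAt-passes (inject₁ j) a u i) (p'' , passes , acc))

  definedByFOTranslation : ∀ {f} → Aperiodic M → Defines M f → DefinedByFOTranslation f
  definedByFOTranslation ap defines = Vec.tabulate φ , translates defines (Vec.tabulate φ)
    λ j w ρ → subst (λ ψ → T (sat w ψ ρ) ⇔ OutputAt (inject₁ j) w ρ) (sym (lookup∘tabulate φ j))
                (correct (def-output ap (inject₁ j)) w ρ)
    where
    φ : Fin t → Formula s 1
    φ j = formula (def-output ap (inject₁ j))

-- Aperiodic automata

map-^^ : ∀ {A B : Set} (f : A → B) u n → map f (u ^^ n) ≡ map f u ^^ n
map-^^ f u zero    = refl
map-^^ f u (suc n) = trans (map-++ f u (u ^^ n)) (cong (map f u ++_) (map-^^ f u n))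

Stable : ∀ {A X : Set} → (X → A → X) → ℕ → Set
Stable d N = ∀ x u → foldl d x (u ^^ N) ≡ foldl d x (u ^^ suc N)

stable-+ : ∀ {A X : Set} {d : X → A → X} {N} → Stable d N → ∀ c → Stable d (c + N)
stable-+ h zero = h
stable-+ {d = d} {N} h (suc c) x u = begin
  foldl d x (u ++ u ^^ (c + N))                 ≡⟨ foldl-++ d x u _ ⟩
  foldl d (foldl d x u) (u ^^ (c + N))          ≡⟨ stable-+ h c (foldl d x u) u ⟩
  foldl d (foldl d x u) (u ++ u ^^ (c + N))     ≡⟨ foldl-++ d x u _ ⟨
  foldl d x (u ++ u ++ u ^^ (c + N))            ∎
  where open ≡-Reasoning

stable-≤ : ∀ {A X : Set} {d : X → A → X} {N n} → Stable d N → N ≤ n → Stable d n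
stable-≤ {d = d} {N} h N≤n = subst (Stable d) (ℕ.m∸n+n≡m N≤n) (stable-+ h (_ ∸ N))

-- Acceptance is kept apart, in `Recognises`, so that one automaton can serve all formulas of a
-- translation.
record Automaton (A : Set) : Set where
  field
    size   : ℕ
    δ      : Fin size → A → Fin size
    q₀     : Fin size
    index  : ℕ
    stable : Stable δ index

  _·_ : Fin size → List A → Fin size
  q · u = foldl δ q u

module _ {A : Set} {k l : ℕ} (d : Fin k × Fin l → A → Fin k × Fin l) where

  pairStep : Fin (k * l) → A → Fin (k * l)
  pairStep c a = uncurry combine (d (remQuot l c) a)

  remQuot-foldl : ∀ c u → remQuot l (foldl pairStep c u) ≡ foldl d (remQuot l c) u
  remQuot-foldl c []      = refl
  remQuot-foldl c (a ∷ u) = trans (remQuot-foldl (pairStep c a) u)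
    (cong (λ x → foldl d x u) (uncurry remQuot-combine (d (remQuot l c) a)))

  pairAutomaton : Fin k × Fin l → (N : ℕ) → Stable d N → Automaton A
  pairAutomaton x N st = record
    { δ      = pairStep
    ; q₀     = uncurry combine x
    ; index  = N
    ; stable = λ c u → begin
        foldl pairStep c (u ^^ N)                                        ≡⟨ combine-remQuot {k} l _ ⟨
        uncurry combine (remQuot {k} l (foldl pairStep c (u ^^ N)))     ≡⟨ cong (uncurry combine) (same c u) ⟩
        uncurry combine (remQuot {k} l (foldl pairStep c (u ^^ suc N))) ≡⟨ combine-remQuot {k} l _ ⟩
        foldl pairStep c (u ^^ suc N)                                    ∎
    }
    where
    open ≡-Reasoning
    same : ∀ c u → remQuot {k} l (foldl pairStep c (u ^^ N)) ≡ remQuot {k} l (foldl pairStep c (u ^^ suc N))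
    same c u = trans (remQuot-foldl c (u ^^ N)) (trans (st (remQuot l c) u) (sym (remQuot-foldl c (u ^^ suc N))))

  remQuot-start : ∀ x u → remQuot l (foldl pairStep (uncurry combine x) u) ≡ foldl d x u
  remQuot-start x u = trans (remQuot-foldl (uncurry combine x) u)
    (cong (λ y → foldl d y u) (uncurry remQuot-combine x))

module _ {A : Set} (𝓐 𝓑 : Automaton A) where
  private
    module 𝓐 = Automaton 𝓐
    module 𝓑 = Automaton 𝓑

  productStep : Fin 𝓐.size × Fin 𝓑.size → A → Fin 𝓐.size × Fin 𝓑.size
  productStep (p , q) a = 𝓐.δ p a , 𝓑.δ q a

  foldl-product : ∀ p q u → foldl productStep (p , q) u ≡ (p 𝓐.· u , q 𝓑.· u)
  foldl-product p q []      = refl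
  foldl-product p q (a ∷ u) = foldl-product (𝓐.δ p a) (𝓑.δ q a) u

  product-stable : Stable productStep (𝓐.index + 𝓑.index)
  product-stable (p , q) u = trans (foldl-product p q (u ^^ (𝓐.index + 𝓑.index))) (trans
    (cong₂ _,_ (stable-≤ 𝓐.stable (ℕ.m≤m+n 𝓐.index 𝓑.index) p u) (stable-+ {d = 𝓑.δ} 𝓑.stable 𝓐.index q u))
    (sym (foldl-product p q (u ^^ suc (𝓐.index + 𝓑.index)))))

  infixr 5 _⊗_
  _⊗_ : Automaton A
  _⊗_ = pairAutomaton productStep (𝓐.q₀ , 𝓑.q₀) (𝓐.index + 𝓑.index) product-stable

-- Guessing one position: f₁ rewrites the letter there and f₀ all other letters.
module Projection {A B : Set} (f₀ f₁ : A → B) (𝓑 : Automaton B) where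
  open Automaton 𝓑

  data Flagged : List A → List B → Set where
    here  : ∀ {a u} → Flagged (a ∷ u) (f₁ a ∷ map f₀ u)
    there : ∀ {a u v} → Flagged u v → Flagged (a ∷ u) (f₀ a ∷ v)

  flagged-++ : ∀ u {w v} → Flagged (u ++ w) v →
    (∃ λ v₁ → Flagged u v₁ × v ≡ v₁ ++ map f₀ w) ⊎ (∃ λ v₂ → Flagged w v₂ × v ≡ map f₀ u ++ v₂)
  flagged-++ []      h = inj₂ (_ , h , refl)
  flagged-++ (a ∷ u) here = inj₁ (_ , here , cong (f₁ a ∷_) (map-++ f₀ u _))
  flagged-++ (a ∷ u) (there h) with flagged-++ u h
  ... | inj₁ (_ , h₁ , e) = inj₁ (_ , there h₁ , cong (f₀ a ∷_) e)
  ... | inj₂ (_ , h₂ , e) = inj₂ (_ , h₂ , cong (f₀ a ∷_) e)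

  ++-flaggedˡ : ∀ {u v} w → Flagged u v → Flagged (u ++ w) (v ++ map f₀ w)
  ++-flaggedˡ w (here {a} {u}) = subst (λ v → Flagged (a ∷ u ++ w) (f₁ a ∷ v)) (map-++ f₀ u w) here
  ++-flaggedˡ w (there h)      = there (++-flaggedˡ w h)

  ++-flaggedʳ : ∀ u {w v} → Flagged w v → Flagged (u ++ w) (map f₀ u ++ v)
  ++-flaggedʳ []      h = h
  ++-flaggedʳ (a ∷ u) h = there (++-flaggedʳ u h)

  around : List A → ℕ → List B → ℕ → List B
  around u i v j = (map f₀ u ^^ i) ++ v ++ (map f₀ u ^^ j)

  -- The flag falls into exactly one copy of `u`; the `i` copies before and the `j` copies after are
  -- unmarked.
  flagged-^^ : ∀ u n {v} → Flagged (u ^^ n) v →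
    ∃₂ λ i j → ∃ λ v' → suc (i + j) ≡ n × Flagged u v' × v ≡ around u i v' j
  flagged-^^ u (suc n) h with flagged-++ u h
  ... | inj₁ (v' , h₁ , e) = 0 , n , v' , refl , h₁ , trans e (cong (v' ++_) (map-^^ f₀ u n))
  ... | inj₂ (v₂ , h₂ , e) with flagged-^^ u n h₂
  ... | i , j , v' , refl , h' , refl =
    suc i , j , v' , refl , h' , trans e (sym (++-assoc (map f₀ u) (map f₀ u ^^ i) _))

  ^^-flagged : ∀ {u v} i j → Flagged u v → Flagged (u ^^ suc (i + j)) (around u i v j)
  ^^-flagged {u} {v} zero j h =
    subst (λ x → Flagged (u ++ u ^^ j) (v ++ x)) (map-^^ f₀ u j) (++-flaggedˡ (u ^^ j) h)
  ^^-flagged {u} {v} (suc i) j h =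
    subst (Flagged (u ^^ suc (suc i + j))) (sym (++-assoc (map f₀ u) (map f₀ u ^^ i) _))
      (++-flaggedʳ u (^^-flagged i j h))

  ·-around : ∀ q u i v j → q · around u i v j ≡ ((q · (map f₀ u ^^ i)) · v) · (map f₀ u ^^ j)
  ·-around q u i v j = trans (foldl-++ δ q (map f₀ u ^^ i) _) (foldl-++ δ _ v _)

  around-sucˡ : ∀ q u {i} v j → index ≤ i → q · around u i v j ≡ q · around u (suc i) v j
  around-sucˡ q u {i} v j h = trans (·-around q u i v j) (trans
    (cong (λ p → (p · v) · (map f₀ u ^^ j)) (stable-≤ stable h q (map f₀ u)))
    (sym (·-around q u (suc i) v j)))

  around-sucʳ : ∀ q u i v {j} → index ≤ j → q · around u i v j ≡ q · around u i v (suc j)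
  around-sucʳ q u i v {j} h = trans (·-around q u i v j) (trans
    (stable-≤ stable h _ (map f₀ u))
    (sym (·-around q u i v (suc j))))

  Next : Fin size → Subset size → A → Fin size → Set
  Next q S a x = (∃ λ y → y ∈ S × δ y (f₀ a) ≡ x) ⊎ δ q (f₁ a) ≡ x

  next? : ∀ q S a x → Dec (Next q S a x)
  next? q S a x = (any? λ y → y ∈? S ×-dec δ y (f₀ a) ≟ x) ⊎-dec δ q (f₁ a) ≟ x

  -- The state reached without a flag, and those reached after having placed it.
  projectStep : Fin size × Subset size → A → Fin size × Subset size
  projectStep (q , S) a = δ q (f₀ a) , subset (next? q S a)

  Reachable : Fin size → Subset size → List A → Fin size → Set
  Reachable q S u x = (∃ λ y → y ∈ S × y · map f₀ u ≡ x) ⊎ (∃ λ v → Flagged u v × q · v ≡ x)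

  project-unflagged : ∀ q S u → proj₁ (foldl projectStep (q , S) u) ≡ q · map f₀ u
  project-unflagged q S []      = refl
  project-unflagged q S (a ∷ u) = project-unflagged (δ q (f₀ a)) (subset (next? q S a)) u

  project-flagged : ∀ q S u x → x ∈ proj₂ (foldl projectStep (q , S) u) ⇔ Reachable q S u x
  project-flagged q S [] x = mk⇔ (λ h → inj₁ (x , h , refl))
    (λ { (inj₁ (y , h , refl)) → h ; (inj₂ (_ , () , _)) })
  project-flagged q S (a ∷ u) x = mk⇔
    (λ h → fwd (to (project-flagged (δ q (f₀ a)) S' u x) h))
    (λ h → from (project-flagged (δ q (f₀ a)) S' u x) (bwd h))
    where
    S' : Subset size
    S' = subset (next? q S a)
    fwd : Reachable (δ q (f₀ a)) S' u x → Reachable q S (a ∷ u) x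
    fwd (inj₂ (v , h , e)) = inj₂ (_ , there h , e)
    fwd (inj₁ (y , h , e)) with to (∈-subset (next? q S a) y) h
    ... | inj₁ (z , h' , refl) = inj₁ (z , h' , e)
    ... | inj₂ refl            = inj₂ (_ , here , e)
    bwd : Reachable q S (a ∷ u) x → Reachable (δ q (f₀ a)) S' u x
    bwd (inj₁ (y , h , e)) = inj₁ (_ , from (∈-subset (next? q S a) _) (inj₁ (y , h , refl)) , e)
    bwd (inj₂ (_ , here , e)) = inj₁ (_ , from (∈-subset (next? q S a) _) (inj₂ refl) , e)
    bwd (inj₂ (_ , there h , e)) = inj₂ (_ , h , e)

  -- One copy of the repeated word holds the flag. The other `index + index` copies leave at least
  -- `index` on one side, which can gain a copy unnoticed; with one copy more, some side has over
  -- `index` and can lose one.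
  bound : ℕ
  bound = suc (index + index)

  private
    other-≥ : ∀ {i j a b} → i ≤ a → i + j ≡ a + b → b ≤ j
    other-≥ {i} {j} {a} {b} i≤a e =
      ℕ.+-cancelˡ-≤ i b j (ℕ.≤-trans (ℕ.+-monoˡ-≤ b i≤a) (ℕ.≤-reflexive (sym e)))

    Hit : Fin size → List A → ℕ → Fin size → Set
    Hit q u n x = ∃ λ v → Flagged (u ^^ n) v × q · v ≡ x

    hit : ∀ q u i {v'} j {n x} → suc (i + j) ≡ n → Flagged u v' → q · around u i v' j ≡ x → Hit q u n x
    hit q u i j refl h e = _ , ^^-flagged i j h , e

    grow : ∀ q u {x} → Hit q u bound x → Hit q u (suc bound) x
    grow q u (v , h , refl) with flagged-^^ u bound h
    ... | i , j , v' , e , h' , refl with ℕ.≤-total index i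
    ... | inj₁ N≤i = hit q u (suc i) j (cong suc e) h' (sym (around-sucˡ q u v' j N≤i))
    ... | inj₂ i≤N = hit q u i (suc j) (cong suc (trans (ℕ.+-suc i j) e)) h'
      (sym (around-sucʳ q u i v' (other-≥ i≤N (ℕ.suc-injective e))))

    shrink : ∀ q u {x} → Hit q u (suc bound) x → Hit q u bound x
    shrink q u (v , h , refl) with flagged-^^ u (suc bound) h
    ... | i , j , v' , e , h' , refl with ℕ.<-≤-connex index i
    ... | inj₁ (s≤s {n = i'} N≤i') = hit q u i' j (ℕ.suc-injective e) h' (around-sucˡ q u v' j N≤i')
    ... | inj₂ i≤N with other-≥ i≤N (trans (ℕ.suc-injective e) (sym (ℕ.+-suc index index)))
    ... | s≤s {n = j'} N≤j' = hit q u i j' (trans (sym (ℕ.+-suc i j')) (ℕ.suc-injective e)) h'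
      (around-sucʳ q u i v' N≤j')

  bound-≥ : index ≤ bound
  bound-≥ = ℕ.m≤n⇒m≤1+n (ℕ.m≤m+n index index)

  unflagged-stable : ∀ q u → q · map f₀ (u ^^ bound) ≡ q · map f₀ (u ^^ suc bound)
  unflagged-stable q u = begin
    q · map f₀ (u ^^ bound)        ≡⟨ cong (q ·_) (map-^^ f₀ u bound) ⟩
    q · (map f₀ u ^^ bound)        ≡⟨ stable-≤ stable bound-≥ q (map f₀ u) ⟩
    q · (map f₀ u ^^ suc bound)    ≡⟨ cong (q ·_) (map-^^ f₀ u (suc bound)) ⟨
    q · map f₀ (u ^^ suc bound)    ∎
    where open ≡-Reasoning

  project-stable : Stable projectStep bound
  project-stable (q , S) u = cong₂ _,_
    (trans (project-unflagged q S (u ^^ bound))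
      (trans (unflagged-stable q u) (sym (project-unflagged q S (u ^^ suc bound)))))
    (subset-ext λ x → mk⇔
      (λ h → from (project-flagged q S (u ^^ suc bound) x) (case to (project-flagged q S (u ^^ bound) x) h of λ where
        (inj₁ (y , y∈ , e)) → inj₁ (y , y∈ , trans (sym (unflagged-stable y u)) e)
        (inj₂ r)            → inj₂ (grow q u r)))
      (λ h → from (project-flagged q S (u ^^ bound) x) (case to (project-flagged q S (u ^^ suc bound) x) h of λ where
        (inj₁ (y , y∈ , e)) → inj₁ (y , y∈ , trans (unflagged-stable y u) e)
        (inj₂ r)            → inj₂ (shrink q u r))))

  none? : (x : Fin size) → Dec ⊥
  none? _ = no id

  ∅ : Subset size
  ∅ = subset none?

  projection : Automaton A
  projection = pairAutomaton projectStep (q₀ , ∅) bound project-stable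

  module _ {P : Fin size → Set} (P? : ∀ x → Dec (P x)) where

    Hits : Fin (Automaton.size projection) → Set
    Hits c = ∃ λ x → x ∈ proj₂ (remQuot {size} (2 ^ size) c) × P x

    hits? : ∀ c → Dec (Hits c)
    hits? c = any? λ x → x ∈? proj₂ (remQuot {size} (2 ^ size) c) ×-dec P? x

    hits-projection : ∀ u → Hits (foldl (Automaton.δ projection) (Automaton.q₀ projection) u) ⇔
      (∃ λ v → Flagged u v × P (q₀ · v))
    hits-projection u = mk⇔ fwd bwd
      where
      state : remQuot {size} (2 ^ size) (foldl (Automaton.δ projection) (Automaton.q₀ projection) u) ≡
        foldl projectStep (q₀ , ∅) u
      state = remQuot-start projectStep (q₀ , ∅) u
      fwd : Hits (foldl (Automaton.δ projection) (Automaton.q₀ projection) u) → ∃ λ v → Flagged u v × P (q₀ · v)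
      fwd (x , h , p) with to (project-flagged q₀ ∅ u x) (subst (x ∈_) (cong proj₂ state) h)
      ... | inj₁ (y , y∈ , _)    = ⊥-elim (to (∈-subset none? y) y∈)
      ... | inj₂ (v , h' , refl) = v , h' , p
      bwd : (∃ λ v → Flagged u v × P (q₀ · v)) → Hits (foldl (Automaton.δ projection) (Automaton.q₀ projection) u)
      bwd (v , h , p) = _ , subst (q₀ · v ∈_) (sym (cong proj₂ state))
        (from (project-flagged q₀ ∅ u (q₀ · v)) (inj₂ (v , h , refl))) , p

-- Recognisable relations on marked words

Letter : ℕ → ℕ → Set
Letter s m = Fin s × Vec Bool m

mark : ∀ {s m} → Bool → Letter s m → Letter s (suc m)
mark b (a , v) = a , b Vec.∷ v

-- A word with an assignment is read as a word in which each letter also records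
-- which variables sit at its position.
letter : ∀ {s m n} → Vec (Fin s) n → (Fin m → Fin n) → Fin n → Letter s m
letter w ρ j = lookup w j , Vec.tabulate λ x → toℕ (ρ x) ≡ᵇ toℕ j

marked : ∀ {s m n} → Vec (Fin s) n → (Fin m → Fin n) → List (Letter s m)
marked w ρ = tabulate (letter w ρ)

record Recognises {s m} (𝓐 : Automaton (Letter s m)) (R : Structural s m) : Set where
  constructor accepting_by_
  open Automaton 𝓐
  field
    accept  : Fin size → Bool
    accepts : ∀ {n} (w : Vec (Fin s) (suc n)) ρ → T (accept (q₀ · marked w ρ)) ⇔ R w ρ

open Recognises

Recognisable : ∀ {s m} → Structural s m → Set
Recognisable R = ∃ λ 𝓐 → Recognises 𝓐 R

module _ {s m : ℕ} where

  recognises-resp : {𝓐 : Automaton (Letter s m)} {R S : Structural s m} → Recognises 𝓐 R →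
    (∀ {n} (w : Vec (Fin s) (suc n)) ρ → R w ρ ⇔ S w ρ) → Recognises 𝓐 S
  recognises-resp (accepting f by c) e = accepting f by λ w ρ → e w ρ ⇔-∘ c w ρ

  rec-resp : {R S : Structural s m} → Recognisable R →
    (∀ {n} (w : Vec (Fin s) (suc n)) ρ → R w ρ ⇔ S w ρ) → Recognisable S
  rec-resp (𝓐 , r) e = 𝓐 , recognises-resp r e

  module _ (𝓐 𝓑 : Automaton (Letter s m)) where
    private
      module 𝓐 = Automaton 𝓐
      module 𝓑 = Automaton 𝓑
      states : Fin (𝓐.size * 𝓑.size) → Fin 𝓐.size × Fin 𝓑.size
      states = remQuot 𝓑.size
      run-⊗ : ∀ u → states (Automaton._·_ (𝓐 ⊗ 𝓑) (Automaton.q₀ (𝓐 ⊗ 𝓑)) u) ≡ (𝓐.q₀ 𝓐.· u , 𝓑.q₀ 𝓑.· u)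
      run-⊗ u = trans (remQuot-start (productStep 𝓐 𝓑) (𝓐.q₀ , 𝓑.q₀) u) (foldl-product 𝓐 𝓑 𝓐.q₀ 𝓑.q₀ u)

    ⊗-recognisesˡ : {R : Structural s m} → Recognises 𝓐 R → Recognises (𝓐 ⊗ 𝓑) R
    ⊗-recognisesˡ (accepting f by c) = accepting f ∘ proj₁ ∘ states by λ w ρ →
      subst (λ x → T (f (proj₁ x)) ⇔ _) (sym (run-⊗ (marked w ρ))) (c w ρ)

    ⊗-recognisesʳ : {R : Structural s m} → Recognises 𝓑 R → Recognises (𝓐 ⊗ 𝓑) R
    ⊗-recognisesʳ (accepting f by c) = accepting f ∘ proj₂ ∘ states by λ w ρ →
      subst (λ x → T (f (proj₂ x)) ⇔ _) (sym (run-⊗ (marked w ρ))) (c w ρ)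

  rec-¬ : {R : Structural s m} → Recognisable R → Recognisable (λ w ρ → ¬ R w ρ)
  rec-¬ (𝓐 , accepting f by c) = 𝓐 , accepting not ∘ f by λ w ρ →
    mk⇔ (λ h r → to (T-not _) h (from (c w ρ) r)) (λ h → from (T-not _) (h ∘ to (c w ρ)))

  rec-× : {R S : Structural s m} → Recognisable R → Recognisable S → Recognisable (λ w ρ → R w ρ × S w ρ)
  rec-× (𝓐 , r) (𝓑 , r') with ⊗-recognisesˡ 𝓐 𝓑 r | ⊗-recognisesʳ 𝓐 𝓑 r'
  ... | accepting f by c | accepting g by d = 𝓐 ⊗ 𝓑 , accepting (λ q → f q ∧ g q) by λ w ρ →
    (c w ρ ×-⇔ d w ρ) ⇔-∘ T-∧

  rec-⊎ : {R S : Structural s m} → Recognisable R → Recognisable S → Recognisable (λ w ρ → R w ρ ⊎ S w ρ)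
  rec-⊎ (𝓐 , r) (𝓑 , r') with ⊗-recognisesˡ 𝓐 𝓑 r | ⊗-recognisesʳ 𝓐 𝓑 r'
  ... | accepting f by c | accepting g by d = 𝓐 ⊗ 𝓑 , accepting (λ q → f q ∨ g q) by λ w ρ →
    (c w ρ ⊎-⇔ d w ρ) ⇔-∘ T-∨

module _ {s m : ℕ} where

  -- The flag serves as the bit of the new variable: flagging `marked w ρ` at position `i` gives
  -- `marked w (extend i ρ)`.
  rec-∃ : {R : Structural s (suc m)} → Recognisable R → Recognisable (λ w ρ → ∃ λ i → R w (extend i ρ))
  rec-∃ {R} (𝓑 , accepting f by c) = projection , accepting (λ q → ⌊ hits? accepted? q ⌋) by λ w ρ →
    mk⇔ (λ h → case to (hits-projection accepted? (marked w ρ)) (toWitness h) of λ (v , fl , acc) →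
          let i , e = position (letter w ρ) fl in
          i , to (c w (extend i ρ)) (subst (λ v → T (f (q₀ · v))) e acc))
        (λ (i , r) → fromWitness (from (hits-projection accepted? (marked w ρ))
          (_ , flag (letter w ρ) i , from (c w (extend i ρ)) r)))
    where
    open Automaton 𝓑
    open Projection (mark false) (mark true) 𝓑
    accepted? : ∀ q → Dec (T (f q))
    accepted? q = T? (f q)
    position : ∀ {n} (g : Fin n → Letter s m) {v} → Flagged (tabulate g) v →
      ∃ λ (i : Fin n) → v ≡ tabulate λ j → mark (toℕ i ≡ᵇ toℕ j) (g j)
    position {suc n} g here = zero , cong (_ ∷_) (map-tabulate (g ∘ suc) (mark false))
    position {suc n} g (there h) with position (g ∘ suc) h
    ... | i , e = suc i , cong (_ ∷_) e
    flag : ∀ {n} (g : Fin n → Letter s m) (i : Fin n) →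
      Flagged (tabulate g) (tabulate λ j → mark (toℕ i ≡ᵇ toℕ j) (g j))
    flag g zero    = subst (λ u → Flagged (tabulate g) (mark true (g zero) ∷ u))
      (map-tabulate (g ∘ suc) (mark false)) here
    flag g (suc i) = there (flag (g ∘ suc) i)

module _ {s m : ℕ} where

  -- Passing from "no counterexample" to "all" needs `R` to be decidable; the automaton that accepts
  -- it decides it.
  rec-∀ : {R : Structural s (suc m)} → Recognisable R → Recognisable (λ w ρ → ∀ i → R w (extend i ρ))
  rec-∀ r@(_ , accepting _ by c) = rec-resp (rec-¬ (rec-∃ (rec-¬ r))) (λ w ρ → mk⇔
    (λ h i → case T? _ of λ where
      (yes t) → to (c w (extend i ρ)) t
      (no ¬t) → ⊥-elim (h (i , ¬t ∘ from (c w (extend i ρ)))))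
    (λ h (i , ¬r) → ¬r (h i)))

-- Automata for the atomic formulas

-- From state 0 the automaton looks for a `p`-letter and then, strictly later, an `r`-letter; from
-- state 1 it looks for an `r`-letter only.
module Precedence {A : Set} (p r : A → Bool) where

  δ : Fin 3 → A → Fin 3
  δ zero             a = if p a then suc zero else zero
  δ (suc zero)       a = if r a then suc (suc zero) else suc zero
  δ (suc (suc zero)) a = suc (suc zero)

  final : ∀ u → foldl δ (suc (suc zero)) u ≡ suc (suc zero)
  final []      = refl
  final (a ∷ u) = final u

  no-return : ∀ u → ¬ foldl δ (suc zero) u ≡ zero
  no-return [] ()
  no-return (a ∷ u) with r a
  ... | true  = λ e → case trans (sym (final u)) e of λ ()
  ... | false = no-return u

  -- States only move up a chain of three, so reading `u` twice leads to a state that `u` fixes.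
  stable : Stable δ 2
  stable x u = begin
    foldl δ x (u ++ u ++ [])        ≡⟨ trans (foldl-++ δ x u _) (foldl-++ δ (f x) u _) ⟩
    f (f x)                         ≡⟨ settle x ⟩
    f (f (f x))                     ≡⟨ trans (foldl-++ δ x u _) (trans (foldl-++ δ (f x) u _)
                                                                       (foldl-++ δ (f (f x)) u _)) ⟨
    foldl δ x (u ++ u ++ u ++ [])   ∎
    where
    open ≡-Reasoning
    f : Fin 3 → Fin 3
    f x = foldl δ x u
    settle₁ : f (suc zero) ≡ f (f (suc zero))
    settle₁ with f (suc zero) in e
    ... | zero           = contradiction e (no-return u)
    ... | suc zero       = sym e
    ... | suc (suc zero) = sym (final u)
    settle : ∀ x → f (f x) ≡ f (f (f x))
    settle (suc zero) = cong f settle₁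
    settle (suc (suc zero)) = cong f (sym (cong f (final u)))
    settle zero with f zero in e
    ... | zero           = cong f (sym e)
    ... | suc zero       = settle₁
    ... | suc (suc zero) = sym (cong f (final u))

  automaton : Fin 3 → Automaton A
  automaton q = record { δ = δ ; q₀ = q ; index = 2 ; stable = stable }

  done? : Fin 3 → Bool
  done? q = ⌊ q ≟ suc (suc zero) ⌋

  seen : ∀ {n} (g : Fin n → A) →
    T (done? (foldl δ (suc zero) (tabulate g))) ⇔ ∃ λ j → T (r (g j))
  seen {zero}  g = mk⇔ (λ ()) (λ ())
  seen {suc n} g with r (g zero) in e
  ... | true  = mk⇔ (λ _ → zero , subst T (sym e) tt) (λ _ → fromWitness (final (tabulate (g ∘ suc))))
  ... | false = mk⇔ (λ h → let j , rⱼ = to (seen (g ∘ suc)) h in suc j , rⱼ) λ where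
    (zero  , rⱼ) → ⊥-elim (subst T e rⱼ)
    (suc j , rⱼ) → from (seen (g ∘ suc)) (j , rⱼ)

  seen₂ : ∀ {n} (g : Fin n → A) → T (done? (foldl δ zero (tabulate g))) ⇔
    ∃₂ λ i j → toℕ i < toℕ j × T (p (g i)) × T (r (g j))
  seen₂ {zero}  g = mk⇔ (λ ()) (λ ())
  seen₂ {suc n} g with p (g zero) in e
  ... | true = mk⇔
    (λ h → let j , rⱼ = to (seen (g ∘ suc)) h in zero , suc j , z<s , subst T (sym e) tt , rⱼ)
    λ { (i , suc j , _ , _ , rⱼ) → from (seen (g ∘ suc)) (j , rⱼ) }
  ... | false = mk⇔
    (λ h → let i , j , i<j , pᵢ , rⱼ = to (seen₂ (g ∘ suc)) h in suc i , suc j , s<s i<j , pᵢ , rⱼ)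
    λ { (zero  , _     , _       , pᵢ , _)  → ⊥-elim (subst T e pᵢ)
      ; (suc i , suc j , s<s i<j , pᵢ , rⱼ) → from (seen₂ (g ∘ suc)) (i , j , i<j , pᵢ , rⱼ) }

module _ {s m : ℕ} where

  private
    at-var : ∀ {n} (ρ : Fin m → Fin n) x j →
      T (lookup (Vec.tabulate λ x → toℕ (ρ x) ≡ᵇ toℕ j) x) ⇔ ρ x ≡ j
    at-var ρ x j = subst (λ b → T b ⇔ ρ x ≡ j) (sym (lookup∘tabulate (λ x → toℕ (ρ x) ≡ᵇ toℕ j) x))
      (mk⇔ (toℕ-injective ∘ ≡ᵇ⇒≡ (toℕ (ρ x)) (toℕ j)) (≡⇒≡ᵇ (toℕ (ρ x)) (toℕ j) ∘ cong toℕ))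

  rec-letter : ∀ a x → Recognisable {s} {m} (λ w ρ → lookup w (ρ x) ≡ a)
  rec-letter a x = automaton (suc zero) , accepting done? by λ w ρ → mk⇔
    (λ h → let j , h' = to (seen (letter w ρ)) h ; e , e' = to T-∧ h' in
      trans (cong (lookup w) (to (at-var ρ x j) e')) (toWitness e))
    (λ e → from (seen (letter w ρ)) (ρ x , from T-∧ (fromWitness e , from (at-var ρ x (ρ x)) refl)))
    where
    open Precedence {Letter s m} (λ _ → false) (λ (b , v) → ⌊ b ≟ a ⌋ ∧ lookup v x)

  rec-< : ∀ x y → Recognisable {s} {m} (λ w ρ → toℕ (ρ x) < toℕ (ρ y))
  rec-< x y = automaton zero , accepting done? by λ w ρ → mk⇔
    (λ h → let i , j , i<j , eᵢ , eⱼ = to (seen₂ (letter w ρ)) h in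
      subst₂ (λ i j → toℕ i < toℕ j) (sym (to (at-var ρ x i) eᵢ)) (sym (to (at-var ρ y j) eⱼ)) i<j)
    (λ h → from (seen₂ (letter w ρ))
      (ρ x , ρ y , h , from (at-var ρ x (ρ x)) refl , from (at-var ρ y (ρ y)) refl))
    where
    open Precedence {Letter s m} (λ (_ , v) → lookup v x) (λ (_ , v) → lookup v y)

  rec-≡ : ∀ x y → Recognisable {s} {m} (λ w ρ → toℕ (ρ x) ≡ toℕ (ρ y))
  rec-≡ x y = rec-resp (rec-× (rec-¬ (rec-< x y)) (rec-¬ (rec-< y x))) (λ w ρ → mk⇔
    (λ (h , h') → ℕ.≤-antisym (ℕ.≮⇒≥ h') (ℕ.≮⇒≥ h))
    (λ e → (λ h → ℕ.<-irrefl e h) , (λ h → ℕ.<-irrefl (sym e) h)))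

module _ {s : ℕ} where

  rec-term : ∀ {m} (τ : Term m) → Recognisable {s} {suc m} (λ w ρ → toℕ (ρ zero) ≡ toℕ (evalT (ρ ∘ suc) τ))
  rec-term (var x) = rec-≡ zero (suc x)
  rec-term tmin = rec-resp (rec-¬ (rec-∃ (rec-< zero (suc zero)))) (λ w ρ → mk⇔
    (λ h → ℕ.n<1⇒n≡0 (s≤s (ℕ.≮⇒≥ λ 0<ρ → h (zero , 0<ρ))))
    (λ e (i , h) → ℕ.n≮0 (subst (toℕ i <_) e h)))
  rec-term tmax = rec-resp (rec-¬ (rec-∃ (rec-< (suc zero) zero))) (λ {n} w ρ → mk⇔
    (λ h → ℕ.≤-antisym (ℕ.≤-trans (toℕ≤pred[n] (ρ zero)) (ℕ.≤-reflexive (sym (toℕ-fromℕ n))))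
                       (ℕ.≮⇒≥ λ ρ<n → h (fromℕ n , ρ<n)))
    (λ e (i , h) → ℕ.<⇒≱ h (ℕ.≤-trans (toℕ≤pred[n] i)
      (ℕ.≤-reflexive (trans (sym (toℕ-fromℕ n)) (sym e))))))

  -- A term is substituted by quantifying a fresh position equal to it, so that automata are built
  -- for variables only.
  rec-at : ∀ {m} {R : Structural s (suc m)} → Recognisable R → (τ : Term m) →
    Recognisable (λ w ρ → R w (extend (evalT ρ τ) ρ))
  rec-at {R = R} r τ = rec-resp (rec-∃ (rec-× (rec-term τ) r)) (λ w ρ → mk⇔
    (λ (i , e , h) → subst (λ i → R w (extend i ρ)) (toℕ-injective e) h)
    (λ h → evalT ρ τ , refl , h))

  weaken : ∀ {m} → Term m → Term (suc m)
  weaken (var x) = var (suc x)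
  weaken tmin    = tmin
  weaken tmax    = tmax

  evalT-weaken : ∀ {m n} (τ : Term m) i (ρ : Fin m → Fin (suc n)) → evalT (extend i ρ) (weaken τ) ≡ evalT ρ τ
  evalT-weaken (var x) i ρ = refl
  evalT-weaken tmin    i ρ = refl
  evalT-weaken tmax    i ρ = refl

  rec-at₂ : ∀ {m} (R : ℕ → ℕ → Set) →
    Recognisable {s} {suc (suc m)} (λ w ρ → R (toℕ (ρ (suc zero))) (toℕ (ρ zero))) → (τ υ : Term m) →
    Recognisable {s} {m} (λ w ρ → R (toℕ (evalT ρ τ)) (toℕ (evalT ρ υ)))
  rec-at₂ R r τ υ = rec-resp (rec-at (rec-at r (weaken υ)) τ) (λ w ρ →
    let e = cong (λ i → R (toℕ (evalT ρ τ)) (toℕ i)) (evalT-weaken υ (evalT ρ τ) ρ)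
    in mk⇔ (subst id e) (subst id (sym e)))

  formula-recognisable : ∀ {m} (φ : Formula s m) → Recognisable (λ w ρ → T (sat w φ ρ))
  formula-recognisable (P a τ)  = rec-resp (rec-at (rec-letter a zero) τ) (λ w ρ → mk⇔ fromWitness toWitness)
  formula-recognisable (τ <' υ) = rec-resp (rec-at₂ _<_ (rec-< (suc zero) zero) τ υ)
    (λ w ρ → mk⇔ <⇒<ᵇ (<ᵇ⇒< _ _))
  formula-recognisable (τ ≐ υ)  = rec-resp (rec-at₂ _≡_ (rec-≡ (suc zero) zero) τ υ)
    (λ w ρ → mk⇔ (≡⇒≡ᵇ _ _) (≡ᵇ⇒≡ _ _))
  formula-recognisable (¬' φ)   = rec-resp (rec-¬ (formula-recognisable φ))
    (λ w ρ → mk⇔ (from (T-not _)) (to (T-not _)))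
  formula-recognisable (φ ∧' ψ) = rec-resp (rec-× (formula-recognisable φ) (formula-recognisable ψ))
    (λ w ρ → mk⇔ (from T-∧) (to T-∧))
  formula-recognisable (φ ∨' ψ) = rec-resp (rec-⊎ (formula-recognisable φ) (formula-recognisable ψ))
    (λ w ρ → mk⇔ (from T-∨) (to T-∨))
  formula-recognisable (∃' φ)   = rec-resp (rec-∃ (formula-recognisable φ))
    (λ w ρ → let e = anyFin-⇔ (λ i → sat w φ (extend i ρ)) in mk⇔ (from e) (to e))
  formula-recognisable (∀' φ)   = rec-resp (rec-∀ (formula-recognisable φ))
    (λ w ρ → let e = allFin-⇔ (λ i → sat w φ (extend i ρ)) in mk⇔ (from e) (to e))

-- From formulas to transducers

trivialAutomaton : ∀ {A} → Automaton A
trivialAutomaton {A} = record { δ = δ ; q₀ = zero ; index = 0 ; stable = λ q u → unique q (foldl δ q (u ^^ 1)) }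
  where
  δ : Fin 1 → A → Fin 1
  δ q _ = q
  unique : (p q : Fin 1) → p ≡ q
  unique zero zero = refl

formulas-recognisable : ∀ {s m t} (φs : Vec (Formula s m) t) →
  ∃ λ 𝓐 → ∀ j → Recognises 𝓐 (λ w ρ → T (sat w (lookup φs j) ρ))
formulas-recognisable Vec.[] = trivialAutomaton , λ ()
formulas-recognisable (φ Vec.∷ φs) with formula-recognisable φ | formulas-recognisable φs
... | 𝓐 , r | 𝓑 , rs = 𝓐 ⊗ 𝓑 , λ where
  zero    → ⊗-recognisesˡ 𝓐 𝓑 r
  (suc j) → ⊗-recognisesʳ 𝓐 𝓑 (rs j)

pick-cong : ∀ {t} {p p' : Fin t → Bool} → p ≗ p' → pick p ≡ pick p'
pick-cong {zero}  h = refl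
pick-cong {suc t} h = cong₂ (λ b c → if b then zero else suc c) (h zero) (pick-cong (h ∘ suc))

T-injective : ∀ {b c} → T b ⇔ T c → b ≡ c
T-injective {true}  {true}  e = refl
T-injective {true}  {false} e = ⊥-elim (to e tt)
T-injective {false} {true}  e = ⊥-elim (from e tt)
T-injective {false} {false} e = refl

-- A transducer state pairs the automaton's state after the unmarked prefix with a code of the
-- guessed action of the unread, unmarked suffix.
module ToTransducer {s t : ℕ} (𝓐 : Automaton (Letter s 1))
                    (accept : Fin t → Fin (Automaton.size 𝓐) → Bool) where
  open Automaton 𝓐

  k : ℕ
  k = size

  unmarked here : Fin s → Letter s 1
  unmarked a = mark false (a , Vec.[])
  here     a = mark true  (a , Vec.[])

  Code : Set
  Code = Fin (k ^ k)

  apply : Code → Fin k → Fin k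
  apply = finToFun

  code : (Fin k → Fin k) → Code
  code = funToFin

  apply-code : ∀ f q → apply (code f) q ≡ f q
  apply-code = finToFun-funToFin

  code-ext : ∀ {r r'} → apply r ≗ apply r' → r ≡ r'
  code-ext {r} {r'} h = trans (sym (funToFin-finToFin {k} {k} r))
    (trans (funToFin-cong h) (funToFin-finToFin {k} {k} r'))

  after : Fin k → Word s → Fin k
  after l u = l · map unmarked u

  precede : Fin s → Code → Code
  precede a r = code (λ q → apply r (δ q (unmarked a)))

  precedes : Word s → Code → Code
  precedes u r = foldr precede r u

  apply-precedes : ∀ u r q → apply (precedes u r) q ≡ apply r (after q u)
  apply-precedes []      r q = refl
  apply-precedes (a ∷ u) r q = trans (apply-code _ q) (apply-precedes u r (δ q (unmarked a)))

  -- The argument of `accept j` is the state after the whole word with only this position marked,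
  -- provided the guess `r` is right.
  output : Fin k → Fin s → Code → Fin (suc t)
  output l a r = pick λ j → accept j (apply r (δ l (here a)))

  outputs : Fin k → Word s → Code → Word (suc t)
  outputs l []      r = []
  outputs l (a ∷ u) r = output l a (precedes u r) ∷ outputs (δ l (unmarked a)) u r

  nil : Code
  nil = code id

  left : Fin (k * k ^ k) → Fin k
  left c = proj₁ (remQuot {k} (k ^ k) c)

  right : Fin (k * k ^ k) → Code
  right c = proj₂ (remQuot {k} (k ^ k) c)

  Move : Fin k → Fin s → Fin (suc t) → Fin (k * k ^ k) → Set
  Move l a b c = left c ≡ δ l (unmarked a) × b ≡ output l a (right c)

  move? : ∀ l a b c → Dec (Move l a b c)
  move? l a b c = left c ≟ δ l (unmarked a) ×-dec b ≟ output l a (right c)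

  -- The single initial state cannot commit to a guess, so `zero` is added: it makes the first
  -- guess, is never re-entered and accepts the empty word. Elsewhere the guess must end as `nil`,
  -- the action of the empty suffix.
  M : Transducer s t
  M .Transducer.nQ = suc (k * k ^ k)
  M .Transducer.q₀ = zero
  M .Transducer.δ _       a b zero     = false
  M .Transducer.δ zero    a b (suc c') = ⌊ move? q₀ a b c' ⌋
  M .Transducer.δ (suc c) a b (suc c') = ⌊ move? (left c) a b c' ×-dec right c ≟ precede a (right c') ⌋
  M .Transducer.F zero    = true
  M .Transducer.F (suc c) = ⌊ right c ≟ nil ⌋

  -- `left` is determined forwards and `right` backwards, so the first `left` and the last `right`
  -- fix the output.
  run-sound : ∀ {c u v p} → Run M (suc c) u v p → ∃ λ c' → p ≡ suc c' ×
    left c' ≡ after (left c) u × right c ≡ precedes u (right c') × v ≡ outputs (left c) u (right c')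
  run-sound {c} done = c , refl , refl , refl , refl
  run-sound (step {p' = zero} () r)
  run-sound {c} (step {a = a} {p' = suc c₁} {u} d r) with toWitness d | run-sound r
  ... | (e , b≡) , e' | c' , p≡ , l≡ , r≡ , v≡ = c' , p≡ ,
    trans l≡ (cong (λ l → after l u) e) , trans e' (cong (precede a) r≡) ,
    cong₂ _∷_ (trans b≡ (cong (output (left c) a) r≡)) (trans v≡ (cong (λ l → outputs l u (right c')) e))

  run-complete : ∀ {c} u c' → left c' ≡ after (left c) u → right c ≡ precedes u (right c') →
    Run M (suc c) u (outputs (left c) u (right c')) (suc c')
  run-complete {c} [] c' l≡ r≡ = subst (λ x → Run M (suc c) [] [] (suc x)) c≡c' done
    where
    c≡c' : c ≡ c'
    c≡c' = trans (sym (combine-remQuot {k} (k ^ k) c))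
      (trans (cong₂ combine (sym l≡) r≡) (combine-remQuot {k} (k ^ k) c'))
  run-complete {c} (a ∷ u) c' l≡ r≡ =
    step (fromWitness ((left≡ , cong (output (left c) a) (sym right≡)) , trans r≡ (cong (precede a) (sym right≡))))
         (subst (λ l → Run M (suc c₁) u (outputs l u (right c')) (suc c')) left≡
           (run-complete u c' (trans l≡ (cong (λ l → after l u) (sym left≡))) right≡))
    where
    c₁ : Fin (k * k ^ k)
    c₁ = combine (δ (left c) (unmarked a)) (precedes u (right c'))
    left≡ : left c₁ ≡ δ (left c) (unmarked a)
    left≡ = cong proj₁ (remQuot-combine (δ (left c) (unmarked a)) (precedes u (right c')))
    right≡ : right c₁ ≡ precedes u (right c')
    right≡ = cong proj₂ (remQuot-combine (δ (left c) (unmarked a)) (precedes u (right c')))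

  run₀-sound : ∀ {a u v p} → Run M zero (a ∷ u) v p → ∃ λ c' → p ≡ suc c' ×
    left c' ≡ after q₀ (a ∷ u) × v ≡ outputs q₀ (a ∷ u) (right c')
  run₀-sound (step {p' = zero} () r)
  run₀-sound {a} {u} (step {p' = suc c₁} d r) with toWitness d | run-sound r
  ... | e , b≡ | c' , p≡ , l≡ , r≡ , v≡ = c' , p≡ , trans l≡ (cong (λ l → after l u) e) ,
    cong₂ _∷_ (trans b≡ (cong (output q₀ a) r≡)) (trans v≡ (cong (λ l → outputs l u (right c')) e))

  run₀-complete : ∀ a u c' → left c' ≡ after q₀ (a ∷ u) →
    Run M zero (a ∷ u) (outputs q₀ (a ∷ u) (right c')) (suc c')
  run₀-complete a u c' l≡ =
    step (fromWitness (left≡ , cong (output q₀ a) (sym right≡)))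
         (subst (λ l → Run M (suc c₁) u (outputs l u (right c')) (suc c')) left≡
           (run-complete u c' (trans l≡ (cong (λ l → after l u) (sym left≡))) right≡))
    where
    c₁ : Fin (k * k ^ k)
    c₁ = combine (δ q₀ (unmarked a)) (precedes u (right c'))
    left≡ : left c₁ ≡ δ q₀ (unmarked a)
    left≡ = cong proj₁ (remQuot-combine (δ q₀ (unmarked a)) (precedes u (right c')))
    right≡ : right c₁ ≡ precedes u (right c')
    right≡ = cong proj₂ (remQuot-combine (δ q₀ (unmarked a)) (precedes u (right c')))

  defines : Defines M (λ w → outputs q₀ w nil)
  defines [] = (zero , done , tt) , λ { .[] (_ , done , _) → refl }
  defines (a ∷ u) =
    (suc c , subst (λ r → Run M zero (a ∷ u) (outputs q₀ (a ∷ u) r) (suc c)) right≡ (run₀-complete a u c left≡) ,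
      fromWitness right≡) ,
    λ v (p , r , acc) → unique r acc
    where
    c : Fin (k * k ^ k)
    c = combine (after q₀ (a ∷ u)) nil
    left≡ : left c ≡ after q₀ (a ∷ u)
    left≡ = cong proj₁ (remQuot-combine (after q₀ (a ∷ u)) nil)
    right≡ : right c ≡ nil
    right≡ = cong proj₂ (remQuot-combine (after q₀ (a ∷ u)) nil)
    unique : ∀ {v p} → Run M zero (a ∷ u) v p → T (Transducer.F M p) → v ≡ outputs q₀ (a ∷ u) nil
    unique r acc with run₀-sound r
    ... | c' , refl , _ , v≡ = trans v≡ (cong (outputs q₀ (a ∷ u)) (toWitness acc))

  -- Words matter only through their action, which moves `left` forwards and `right` backwards. Both
  -- words are nonempty because only the empty word keeps `zero` in place.
  reach-cong : ∀ {a b u v} → (∀ l → after l (a ∷ u) ≡ after l (b ∷ v)) → ∀ {p p'} →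
    Reach M p (a ∷ u) p' → Reach M p (b ∷ v) p'
  reach-cong h {zero} (_ , r) with run₀-sound r
  ... | c' , refl , l≡ , _ = _ , run₀-complete _ _ c' (trans l≡ (h q₀))
  reach-cong {a} {b} {u} {v} h {suc c} (_ , r) with run-sound r
  ... | c' , refl , l≡ , r≡ , _ = _ , run-complete _ c' (trans l≡ (h (left c)))
    (trans r≡ (code-ext λ q → trans (apply-precedes (a ∷ u) (right c') q)
      (trans (cong (apply (right c')) (h q)) (sym (apply-precedes (b ∷ v) (right c') q)))))

  aperiodic : Aperiodic M
  -- `index` may be 0, and the power 0 of a nonempty word stays at `zero` while its power 1 does
  -- not; `suc` excludes this case.
  aperiodic = suc index , λ p u p' → powers p u p'
    where
    []-^^ : ∀ n → [] ^^ n ≡ ([] {A = Fin s})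
    []-^^ zero    = refl
    []-^^ (suc n) = []-^^ n
    after-stable : ∀ u l → after l (u ^^ suc index) ≡ after l (u ^^ suc (suc index))
    after-stable u l = begin
      after l (u ^^ suc index)             ≡⟨ cong (l ·_) (map-^^ unmarked u (suc index)) ⟩
      l · (map unmarked u ^^ suc index)    ≡⟨ stable-+ {d = δ} {index} stable 1 l (map unmarked u) ⟩
      l · (map unmarked u ^^ (2 + index))  ≡⟨ cong (l ·_) (map-^^ unmarked u (2 + index)) ⟨
      after l (u ^^ suc (suc index))       ∎
      where open ≡-Reasoning
    powers : ∀ p u p' → Reach M p (u ^^ suc index) p' ⇔ Reach M p (u ^^ suc (suc index)) p'
    powers p [] p' = subst₂ (λ w w' → Reach M p w p' ⇔ Reach M p w' p')
      (sym ([]-^^ (suc index))) (sym ([]-^^ (suc (suc index)))) (mk⇔ id id)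
    powers p (a ∷ u) p' = mk⇔ (reach-cong (after-stable (a ∷ u))) (reach-cong (sym ∘ after-stable (a ∷ u)))

  tabulate-unmarked : ∀ u → tabulate (λ j → lookup (fromList u) j , false Vec.∷ Vec.[]) ≡ map unmarked u
  tabulate-unmarked []      = refl
  tabulate-unmarked (a ∷ u) = cong (unmarked a ∷_) (tabulate-unmarked u)

  marks : (w : Word s) → Fin (length w) → List (Letter s 1)
  marks w i = tabulate λ j → lookup (fromList w) j , (toℕ i ≡ᵇ toℕ j) Vec.∷ Vec.[]

  outputs-tabulate : ∀ l w →
    toList (Vec.tabulate λ i → pick λ j → accept j (l · marks w i)) ≡ outputs l w nil
  outputs-tabulate l []      = refl
  outputs-tabulate l (a ∷ u) = cong₂ _∷_
    (pick-cong λ j → cong (accept j) (begin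
      δ l (here a) · tabulate (λ j → lookup (fromList u) j , false Vec.∷ Vec.[])
        ≡⟨ cong (δ l (here a) ·_) (tabulate-unmarked u) ⟩
      after (δ l (here a)) u                     ≡⟨ apply-code id _ ⟨
      apply nil (after (δ l (here a)) u)         ≡⟨ apply-precedes u nil _ ⟨
      apply (precedes u nil) (δ l (here a))      ∎))
    (outputs-tabulate (δ l (unmarked a)) u)
    where open ≡-Reasoning

definedByTransducer : ∀ {s t} {f : Word s → Word (suc t)} → DefinedByFOTranslation f →
  Σ (Transducer s t) (λ M → SingleValued M × Aperiodic M × Defines M f)
definedByTransducer {s} {t} {f} (φs , f≡) = M , (λ w → f w , df w) , aperiodic , df
  where
  𝓐 : Automaton (Letter s 1)
  𝓐 = proj₁ (formulas-recognisable φs)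
  rec : ∀ j → Recognises 𝓐 (λ w ρ → T (sat w (lookup φs j) ρ))
  rec = proj₂ (formulas-recognisable φs)
  open ToTransducer {t = t} 𝓐 (λ j → accept (rec j))

  translate≡ : ∀ w → translate φs w ≡ outputs (Automaton.q₀ 𝓐) w nil
  translate≡ []      = refl
  translate≡ (a ∷ u) = trans
    (cong toList (Vec.tabulate-cong λ i → pick-cong λ j → T-injective
      (mk⇔ (from (accepts (rec j) (fromList (a ∷ u)) (λ _ → i))) (to (accepts (rec j) (fromList (a ∷ u)) (λ _ → i))))))
    (outputs-tabulate (Automaton.q₀ 𝓐) (a ∷ u))

  df : Defines M f
  df w = subst (λ v → Output M w v × (∀ v' → Output M w v' → v' ≡ v))
    (sym (trans (f≡ w) (translate≡ w))) (defines w)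

theorem10 : ∀ {s t : ℕ} (f : Word s → Word (suc t)) →
    DefinedByFOTranslation f ⇔
    Σ (Transducer s t) (λ M → SingleValued M × Aperiodic M × Defines M f)
theorem10 f = mk⇔ definedByTransducer λ (M , _ , ap , df) → FromTransducer.definedByFOTranslation M ap df
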